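{- Let $p>3$ be a prime and $a,b\in\mathbb{Q}_p$ with $ab\neq0$. The cubic equation $x^3+ax=b$ is: I. solvable in $\mathbb{Z}_p^{*}$ if and only if one of the following holds: (I.1) $|a|_p<|b|_p=1$ and $\sqrt[3]{b}$ exists; (I.2) $|b|_p<|a|_p=1$ and $\sqrt{ -a}$ exists; (I.3) $|a|_p=|b|_p=1$ and $D_0u_{p-2}^2\not\equiv 9a_0^2\pmod p$; (I.4) $|a|_p=|b|_p>1$. II. solvable in $\mathbb{Z}_p\setminus\mathbb{Z}_p^{*}$ if and only if one of the following holds: (II.1) $|a|_p^3<|b|_p^2<1$ and $\sqrt[3]{b}$ exists; (II.2) $|a|_p^3=|b|_p^2<1$ and $D_0u_{p-2}^2\not\equiv 9a_0^2\pmod p$; (II.3) $|a|_p^3>|b|_p^2$ and $|a|_p>|b|_p$. III. solvable in $\mathbb{Q}_p\setminus\mathbb{Z}_p$ if and only if one of the following holds: (III.1) $|a|_p^3<|b|_p^2$, $|b|_p>1$ and $\sqrt[3]{b}$ exists; (III.2) $|a|_p^3=|b|_p^2>1$ and $D_0u_{p-2}^2\not\equiv 9a_0^2\pmod p$; (III.3) $|a|_p^3>|b|_p^2$ and either $|a|_p<|b|_p$, or ($|a|_p\ge|b|_p$, $|a|_p>1$ and $\sqrt{ -a}$ exists).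
   Context: Solvable in a set means at least one root lies in that set. $|\cdot|_p$ is the $p$-adic absolute value, $\mathbb{Z}_p=\{x:|x|_p\le1\}$, $\mathbb{Z}_p^{*}=\{x:|x|_p=1\}$. Every nonzero $c\in\mathbb{Q}_p$ is written $c=c^{*}/|c|_p$ with $c^{*}=c_0+c_1p+\cdots\in\mathbb{Z}_p^{*}$, $c_0\in\{1,\dots,p-1\}$, $c_i\in\{0,\dots,p-1\}$. "$\sqrt{c}$ exists" means $c_0^{(p-1)/2}\equiv1\pmod p$ and $\log_p|c|_p$ is even; "$\sqrt[3]{c}$ exists" means $c_0^{(p-1)/\gcd(3,p-1)}\equiv1\pmod p$ and $3\mid\log_p|c|_p$. Set $D_0=-4a_0^3-27b_0^2$ and $u_1=0$, $u_2=-a_0$, $u_3=b_0$, $u_{n+3}=b_0u_n-a_0u_{n+1}$ for $n=1,\dots,p-3$. -}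

module Defs where

open import Data.Nat as ℕ using (ℕ; zero; suc; _<_; _∸_; NonZero; ≢-nonZero)
open import Data.Nat.DivMod using (_/_)
open import Data.Nat.GCD using (gcd; gcd[m,n]≢0)
open import Data.Integer as ℤ using (ℤ; +_; _+_; _-_; _*_; -_; ∣_∣)
open import Data.Integer.Divisibility using (_∣_)
open import Data.Sum using (inj₁)
open import Relation.Nullary using (¬_)
open import Data.Product using (_×_)
open import Relation.Binary.PropositionalEquality using (_≡_; _≢_)

infixr 8 _^ᶻ_
_^ᶻ_ : ℤ → ℕ → ℤ
x ^ᶻ zero = + 1
x ^ᶻ suc n = x * (x ^ᶻ n)

-- A p-adic unit c* = c₀ + c₁ p + c₂ p² + ⋯ ∈ ℤ_p^*, given by its digit
-- expansion: every digit in {0,…,p-1}, and c₀ ∈ {1,…,p-1}.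
record Unit (p : ℕ) : Set where
  constructor mkUnit
  field
    digit    : ℕ → ℕ
    digit<p  : ∀ i → digit i < p
    digit0≢0 : digit 0 ≢ 0
open Unit public

trunc : (p : ℕ) → (ℕ → ℕ) → ℕ → ℤ
trunc p d zero    = + 0
trunc p d (suc n) = trunc p d n + (+ d n) * ((+ p) ^ᶻ n)

-- A nonzero p-adic number c = p^v · c*  (so |c|_p = p^{-v}, log_p |c|_p = -v,
-- and c* is the unit part of the paper's normal form c = c*/|c|_p).
record Qp× (p : ℕ) : Set where
  constructor _·p^_
  field
    unit : Unit p
    val  : ℤ
open Qp× public

c₀ : ∀ {p} → Qp× p → ℕ
c₀ c = digit (unit c) 0

-- Negation: -(p^v c*) = p^v (-c*), and since c₀ ≠ 0,
-- -c* = (p - c₀) + Σ_{i≥1} (p-1-c_i) p^i.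
negDigits : (p : ℕ) → (ℕ → ℕ) → ℕ → ℕ
negDigits p d zero    = p ∸ d zero
negDigits p d (suc i) = (p ∸ 1) ∸ d (suc i)

infix 4 _≡ᵐ_[mod_]
_≡ᵐ_[mod_] : ℤ → ℤ → ℤ → Set
x ≡ᵐ y [mod m ] = m ∣ (x - y)

SqrtExists : (p : ℕ) → (c0 : ℕ) → (v : ℤ) → Set
SqrtExists p c0 v = ((+ c0) ^ᶻ ((p ∸ 1) / 2) ≡ᵐ + 1 [mod + p ]) × ((+ 2) ∣ (- v))

cubeExp : ℕ → ℕ
cubeExp p = _/_ (p ∸ 1) (gcd 3 (p ∸ 1)) {{≢-nonZero (gcd[m,n]≢0 3 (p ∸ 1) (inj₁ (λ ())))}}

CbrtExists : (p : ℕ) → (c0 : ℕ) → (v : ℤ) → Set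
CbrtExists p c0 v = ((+ c0) ^ᶻ cubeExp p ≡ᵐ + 1 [mod + p ]) × ((+ 3) ∣ (- v))

√_exists : ∀ {p} → Qp× p → Set
√_exists {p} c = SqrtExists p (c₀ c) (val c)

-- √(-c) exists: the first digit of -c is p - c₀, |−c|_p = |c|_p
√-_exists : ∀ {p} → Qp× p → Set
√-_exists {p} c = SqrtExists p (negDigits p (digit (unit c)) 0) (val c)

∛_exists : ∀ {p} → Qp× p → Set
∛_exists {p} c = CbrtExists p (c₀ c) (val c)

D₀ : ℕ → ℕ → ℤ
D₀ a0 b0 = - (+ 4) * (+ a0) ^ᶻ 3 - (+ 27) * (+ b0) ^ᶻ 2

-- u₁ = 0, u₂ = -a₀, u₃ = b₀, u_{n+3} = b₀ u_n - a₀ u_{n+1} (n ≥ 1).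
-- (u₀ is not used by the paper; set to 0.)
useq : ℕ → ℕ → ℕ → ℤ
useq a0 b0 0 = + 0
useq a0 b0 1 = + 0
useq a0 b0 2 = - (+ a0)
useq a0 b0 3 = + b0
useq a0 b0 (suc (suc (suc (suc n)))) =
  (+ b0) * useq a0 b0 (suc n) - (+ a0) * useq a0 b0 (suc (suc n))

CondD : (p a0 b0 : ℕ) → Set
CondD p a0 b0 = ¬ (D₀ a0 b0 * (useq a0 b0 (p ∸ 2)) ^ᶻ 2 ≡ᵐ (+ 9) * (+ a0) ^ᶻ 2 [mod + p ])

minℤ : ℤ → ℤ → ℤ
minℤ = ℤ._⊓_

-- x is a root of X³ + aX = b in ℚ_p, for nonzero x = p^w X*, a = p^α A*, b = p^β B*.
-- With m = min(3w, α+w, β) the equation is equivalent (multiply by p^{-m}) to the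
-- equation p^{3w-m} X*³ + p^{α+w-m} A* X* = p^{β-m} B* in ℤ_p, and equality in
-- ℤ_p = lim ℤ/p^n is equality of all truncations mod p^n.
IsRoot : (p : ℕ) → (a b x : Qp× p) → Set
IsRoot p a b x = ∀ n →
    (P ^ᶻ e₁) * (X n ^ᶻ 3) + (P ^ᶻ e₂) * A n * X n ≡ᵐ (P ^ᶻ e₃) * B n [mod P ^ᶻ n ]
  where
  P = + p
  w = val x
  α = val a
  β = val b
  m = minℤ (minℤ ((+ 3) * w) (α + w)) β
  e₁ = ∣ (+ 3) * w - m ∣
  e₂ = ∣ α + w - m ∣
  e₃ = ∣ β - m ∣
  X = trunc p (digit (unit x))
  A = trunc p (digit (unit a))
  B = trunc p (digit (unit b))

{-# OPTIONS --safe #-}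
-- If |x|_p = p^(-w), then at least two of x³, ax, b have the least valuation, and modulo p the
-- equation becomes x³ = b, x² = -a, ax = b or x³ + ax = b in the leading digits. A simple root
-- modulo p lifts digit by digit (Hensel), so only these congruences and linear inequalities
-- between valuations remain.
--
-- For c^m = 1 with dm = p - 1, the polynomial X^(p-1) - 1 = X^(dm) - c^m is divisible by X^d - c;
-- if the latter had no root, its monic cofactor of degree p - 1 - d would have p - 1 roots.
--
-- For the full cubic f = X³ + aX - b, u_{p-2} is the coefficient A of X² in
-- Y = X^p = AX² + BX + C modulo f, and Y is a root of f by Frobenius. If f has no root modulo p,
-- then 𝔽_p[X]/(f) is a domain in which Y ≠ X, so Y² + XY + X² + a = 0, and comparing coefficients
-- gives D₀A² = 9a². If r is a root, put f = (X - r)g and Y ≡ αX + β modulo g; then g(Y) ≡ 0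
-- modulo g and Y(r) = r force α = ±1 as soon as D₀A² = 9a², and both signs are impossible.
module Submission where

open import Defs
open import Algebra.Bundles using (CommutativeRing; CommutativeSemiring)
open import Algebra.Structures.Biased using (isCommutativeSemiringˡ)
open import Data.Empty using (⊥; ⊥-elim)
open import Data.Fin.Base as Fin using (Fin; toℕ; fromℕ; fromℕ<; inject₁)
open import Data.Fin.Properties using (any?; toℕ-fromℕ; toℕ-fromℕ<; toℕ-inject₁; toℕ<n)
import Data.Nat
open import Data.Nat as ℕ using (ℕ; zero; suc; z≤n; s≤s; _!)
open import Data.Nat.Combinatorics
  using (nCn≡1; nCk≡n!/k![n-k]!; k![n∸k]!∣n!) renaming (_C_ to _choose_)
import Data.Nat.Divisibility as ℕ∣
open import Data.Nat.DivMod using (_/_; m/n*n≡m; m*[n/m]≡n)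
open import Data.Nat.GCD using (gcd; gcd[m,n]∣m; gcd[m,n]∣n; gcd-greatest; gcd[m,n]≢0)
open import Data.Nat.Primality
  using (Prime; prime?; euclidsLemma; prime⇒irreducible; prime⇒nonTrivial; prime⇒nonZero)
import Data.Nat.Properties as ℕ
open import Data.Nat.Tactic.RingSolver using () renaming (solve-∀ to solve-∀ℕ)
open import Data.Product using (Σ; ∃; _×_; _,_; proj₁; proj₂; uncurry)
open import Data.Sum as Sum using (_⊎_; inj₁; inj₂; [_,_]′)
open import Function using (_∘_; id)
open import Function.Bundles using (_⇔_; mk⇔)
open import Level using (0ℓ)
open import Relation.Binary.Definitions using (tri<; tri≈; tri>)
open import Relation.Binary.PropositionalEquality
  using (_≡_; refl; cong; cong₂; sym; trans; subst; subst₂; isEquivalence)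
open import Relation.Nullary using (¬_; yes; no)
open import Relation.Nullary.Decidable using (from-yes)

-- Binomial coefficients and Frobenius

-- As a is a unit modulo p, D₀A² ≡ 9a² forces D₀ ≢ 0, so the congruence can hold only for a
-- separable cubic. A cubic with a double root r modulo p is therefore on the solvable side, and
-- there r itself cannot be lifted by Hensel's argument; the remaining root -2r is simple because p
-- > 3.
--
-- All computations stay in the one ring ℤ[X]/(f), on coordinate triples, and reduction modulo g is
-- imitated by multiplication by X - r. Frobenius fixes the roots of g when α = 1 and exchanges them
-- when α = -1.
--
-- Congruences are derived by writing the wanted integer as an explicit linear combination of
-- integers already known to be multiples of p; the coefficients come from eliminating variables by
-- hand, and the ring solver checks the identity.

prime∤! : ∀ {p} → Prime p → ∀ k → k ℕ.< p → ¬ (p ℕ∣.∣ k !)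
prime∤! pp zero k<p p∣1 = ℕ∣.>⇒∤ (ℕ.nonTrivial⇒n>1 _ {{prime⇒nonTrivial pp}}) p∣1
prime∤! pp (suc k) k<p p∣ with euclidsLemma (suc k) (k !) pp p∣
... | inj₁ p∣k = ℕ∣.>⇒∤ k<p p∣k
... | inj₂ p∣k! = prime∤! pp k (ℕ.<-trans (ℕ.n<1+n k) k<p) p∣k!

-- p divides p! = C · k! · (p - k)!, but neither factorial, since both are taken of numbers below p.
prime∣C : ∀ {p} → Prime p → ∀ k → 0 ℕ.< k → k ℕ.< p → p ℕ∣.∣ p choose k
prime∣C {p@(suc p-1)} pp k 0<k k<p with euclidsLemma (p choose k) (k ! ℕ.* (p ℕ.∸ k) !) pp
    (subst (p ℕ∣.∣_) (sym C*k!≡p!) (ℕ∣.m∣m*n (p-1 !)))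
  where
  C*k!≡p! : (p choose k) ℕ.* (k ! ℕ.* (p ℕ.∸ k) !) ≡ p !
  C*k!≡p! = trans (cong (ℕ._* (k ! ℕ.* (p ℕ.∸ k) !)) (nCk≡n!/k![n-k]! (ℕ.<⇒≤ k<p)))
                  (m/n*n≡m {{k ℕ.!* (p ℕ.∸ k) !≢0}} (k![n∸k]!∣n! (ℕ.<⇒≤ k<p)))
... | inj₁ p∣C = p∣C
... | inj₂ p∣k! with euclidsLemma (k !) _ pp p∣k!
... | inj₁ p∣k = ⊥-elim (prime∤! pp k k<p p∣k)
... | inj₂ p∣p-k = ⊥-elim (prime∤! pp (p ℕ.∸ k) (ℕ.∸-monoʳ-< 0<k (ℕ.<⇒≤ k<p)) p∣p-k)

module Frobenius {c ℓ} (S : CommutativeSemiring c ℓ) where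
  open CommutativeSemiring S renaming (refl to ≈-refl; sym to ≈-sym; trans to ≈-trans)
  open import Algebra.Properties.Semiring.Exp semiring using (_^_)
  open import Algebra.Properties.Semiring.Mult semiring using (×-cong; ×-assocˡ) renaming (_×_ to _·_)
  open import Algebra.Properties.CommutativeMonoid.Mult +-commutativeMonoid using (×-distrib-+)
  open import Algebra.Properties.Semiring.Sum semiring using (sum; sum-init-last)
  open import Algebra.Properties.CommutativeSemiring.Binomial S using (theorem; binomialTerm)
  open import Relation.Binary.Reasoning.Setoid setoid

  sum-of-multiples : ∀ m {n} (t : Fin n → Carrier) → (∀ i → ∃ λ w → t i ≈ m · w) →
                     ∃ λ w → sum t ≈ m · w
  sum-of-multiples m {zero} t h = 0# , ≈-sym (multiple-of-0 m)
    where
    multiple-of-0 : ∀ k → k · 0# ≈ 0#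
    multiple-of-0 zero = ≈-refl
    multiple-of-0 (suc k) = ≈-trans (+-identityˡ _) (multiple-of-0 k)
  sum-of-multiples m {suc n} t h with h Fin.zero | sum-of-multiples m (t ∘ Fin.suc) (h ∘ Fin.suc)
  ... | u , tu | v , tv = u + v , ≈-trans (+-cong tu tv) (≈-sym (×-distrib-+ u v m))

  -- Applied to ℤ for Fermat's little theorem and to ℤ[X]/(f) for the Frobenius map. Neither ring
  -- has characteristic p, so the inner binomial terms are kept as an exact multiple of p.
  frobenius-+ : ∀ {p} → Prime p → ∀ x y → ∃ λ w → (x + y) ^ p ≈ (x ^ p + y ^ p) + p · w
  frobenius-+ {p@(suc q)} pp x y = w , (begin
    (x + y) ^ p                                          ≈⟨ theorem p x y ⟩
    binomialTerm x y p Fin.zero + sum middle             ≈⟨ +-cong first (sum-init-last middle) ⟩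
    y ^ p + (sum (middle ∘ inject₁) + middle (fromℕ q))  ≈⟨ +-congˡ (+-cong (proj₂ inner) last) ⟩
    y ^ p + (p · w + x ^ p)                              ≈⟨ +-congˡ (+-comm _ _) ⟩
    y ^ p + (x ^ p + p · w)                              ≈⟨ +-assoc _ _ _ ⟨
    (y ^ p + x ^ p) + p · w                              ≈⟨ +-congʳ (+-comm _ _) ⟩
    (x ^ p + y ^ p) + p · w                              ∎)
    where
    middle : Fin p → Carrier
    middle = binomialTerm x y p ∘ Fin.suc

    multiple : ∀ i → ∃ λ v → middle (inject₁ i) ≈ p · v
    multiple i with prime∣C pp (suc (toℕ (inject₁ i))) (s≤s z≤n)
                      (s≤s (subst (ℕ._< q) (sym (toℕ-inject₁ i)) (toℕ<n i)))
    ... | ℕ∣.divides k eq = k · v , ≈-trans (×-cong (trans eq (ℕ.*-comm k p)) ≈-refl) (≈-sym (×-assocˡ v p k))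
      where
      v : Carrier
      v = (x ^ suc (toℕ (inject₁ i))) * (y ^ (p ℕ.∸ suc (toℕ (inject₁ i))))

    inner : ∃ λ v → sum (middle ∘ inject₁) ≈ p · v
    inner = sum-of-multiples p (middle ∘ inject₁) multiple

    w : Carrier
    w = proj₁ inner

    first : binomialTerm x y p Fin.zero ≈ y ^ p
    first = ≈-trans (+-identityʳ _) (*-identityˡ _)

    last : middle (fromℕ q) ≈ x ^ p
    last rewrite toℕ-fromℕ q | nCn≡1 p | ℕ.n∸n≡0 q = ≈-trans (+-identityʳ _) (*-identityʳ _)

open import Data.Integer as ℤ using (ℤ; +_; -[1+_]; _+_; _-_; _*_; -_; _<_; _≤_)
import Data.Integer.Divisibility as ℤ∣
open import Data.Integer.Divisibility.Signed
open import Data.Integer.DivMod using (_%ℕ_; _/ℕ_; n%ℕd<d; a≡a%ℕn+[a/ℕn]*n)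
import Data.Integer.Properties as ℤ
open import Data.Integer.Tactic.RingSolver using (solve-∀)

-- Congruences modulo a prime

∣-lin₁ : ∀ {m x y} c → m ∣ x → y ≡ c * x → m ∣ y
∣-lin₁ c m∣x refl = ∣n⇒∣m*n c m∣x

∣-lin₂ : ∀ {m x₁ x₂ y} c₁ c₂ → m ∣ x₁ → m ∣ x₂ → y ≡ c₁ * x₁ + c₂ * x₂ → m ∣ y
∣-lin₂ c₁ c₂ m∣x₁ m∣x₂ refl = ∣m∣n⇒∣m+n (∣n⇒∣m*n c₁ m∣x₁) (∣n⇒∣m*n c₂ m∣x₂)

∣-lin₃ : ∀ {m x₁ x₂ x₃ y} c₁ c₂ c₃ → m ∣ x₁ → m ∣ x₂ → m ∣ x₃ →
         y ≡ c₁ * x₁ + c₂ * x₂ + c₃ * x₃ → m ∣ y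
∣-lin₃ c₁ c₂ c₃ m∣x₁ m∣x₂ m∣x₃ refl =
  ∣m∣n⇒∣m+n (∣-lin₂ c₁ c₂ m∣x₁ m∣x₂ refl) (∣n⇒∣m*n c₃ m∣x₃)

^ᶻ≡^ : ∀ x n → x ^ᶻ n ≡ x ℤ.^ n
^ᶻ≡^ x zero = refl
^ᶻ≡^ x (suc n) = cong (x *_) (^ᶻ≡^ x n)

^ᶻ-+ : ∀ x m n → x ^ᶻ (m ℕ.+ n) ≡ x ^ᶻ m * x ^ᶻ n
^ᶻ-+ x m n rewrite ^ᶻ≡^ x (m ℕ.+ n) | ^ᶻ≡^ x m | ^ᶻ≡^ x n = ℤ.^-distribˡ-+-* x m n

^ᶻ-* : ∀ x m n → (x ^ᶻ m) ^ᶻ n ≡ x ^ᶻ (m ℕ.* n)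
^ᶻ-* x m n rewrite ^ᶻ≡^ (x ^ᶻ m) n | ^ᶻ≡^ x m | ^ᶻ≡^ x (m ℕ.* n) = ℤ.^-*-assoc x m n

1^ᶻ : ∀ n → (+ 1) ^ᶻ n ≡ + 1
1^ᶻ n rewrite ^ᶻ≡^ (+ 1) n = ℤ.^-zeroˡ n

^ᶻ-mod : ∀ {m} x y n → m ∣ x - y → m ∣ x ^ᶻ n - y ^ᶻ n
^ᶻ-mod x y zero h = divides (+ 0) refl
^ᶻ-mod x y (suc n) h = ∣-lin₂ x (y ^ᶻ n) (^ᶻ-mod x y n h) h (identity x y (x ^ᶻ n) (y ^ᶻ n))
  where
  identity : ∀ x y u v → x * u - y * v ≡ x * (u - v) + v * (x - y)
  identity = solve-∀

-- Written in Horner form, so that synthetic division by T - r stays monic.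
data Monic : ℕ → (ℤ → ℤ) → Set where
  one    : ∀ {f} → (∀ t → f t ≡ + 1) → Monic 0 f
  horner : ∀ {n f} g c → Monic n g → (∀ t → f t ≡ t * g t + c) → Monic (suc n) f

-- Synthetic division: for f = Tg + c one has f(t) - f(r) = t(g(t) - g(r)) + (t - r)g(r), so g(r) is
-- the next Horner constant of the quotient. The value f(r) is subtracted because r will be a root
-- modulo p only.
monic-quotient : ∀ {n f} → Monic (suc n) f → ∀ r →
                 ∃ λ h → Monic n h × (∀ t → f t - f r ≡ (t - r) * h t)
monic-quotient {f = f} (horner g c (one g≡1) eq) r = (λ _ → + 1) , one (λ _ → refl) , λ t →
  trans (cong₂ _-_ (trans (eq t) (cong (λ z → t * z + c) (g≡1 t)))
                   (trans (eq r) (cong (λ z → r * z + c) (g≡1 r))))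
        (identity t r c)
  where
  identity : ∀ t r c → t * + 1 + c - (r * + 1 + c) ≡ (t - r) * + 1
  identity = solve-∀
monic-quotient {f = f} (horner g c mg@(horner _ _ _ _) eq) r with monic-quotient mg r
... | h , mh , hq = (λ t → t * h t + g r) , horner h (g r) mh (λ _ → refl) , λ t →
  trans (cong₂ _-_ (eq t) (eq r))
    (trans (identity₁ t r c (g t) (g r))
      (trans (cong (λ z → t * z + (t - r) * g r) (hq t)) (identity₂ t r (g r) (h t))))
  where
  identity₁ : ∀ t r c u v → t * u + c - (r * v + c) ≡ t * (u - v) + (t - r) * v
  identity₁ = solve-∀
  identity₂ : ∀ t r v h → t * ((t - r) * h) + (t - r) * v ≡ (t - r) * (t * h + v)
  identity₂ = solve-∀

monic-shift : ∀ {n f} e → Monic n f → Monic (e ℕ.+ n) (λ t → t ^ᶻ e * f t)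
monic-shift {f = f} zero (one eq) = one (λ t → trans (ℤ.*-identityˡ (f t)) (eq t))
monic-shift {f = f} zero (horner g c mg eq) = horner g c mg (λ t → trans (ℤ.*-identityˡ (f t)) (eq t))
monic-shift {f = f} (suc e) mf =
  horner _ (+ 0) (monic-shift e mf) (λ t → trans (ℤ.*-assoc t (t ^ᶻ e) (f t)) (sym (ℤ.+-identityʳ _)))

-- The geometric sum of t^(di) c^(m-i) over 0 ≤ i ≤ m. It has m + 1 terms, so it is the cofactor of
-- t^d - c in t^(d(m+1)) - c^(m+1), and its degree is md.
powerQuotient : ℕ → ℤ → ℕ → ℤ → ℤ
powerQuotient d c zero t = + 1
powerQuotient d c (suc m) t = t ^ᶻ d * powerQuotient d c m t + c ^ᶻ suc m

powerQuotient-correct : ∀ d c m t →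
  (t ^ᶻ d) ^ᶻ suc m - c ^ᶻ suc m ≡ (t ^ᶻ d - c) * powerQuotient d c m t
powerQuotient-correct d c zero t = identity (t ^ᶻ d) c
  where
  identity : ∀ x c → x * + 1 - c * + 1 ≡ (x - c) * + 1
  identity = solve-∀
powerQuotient-correct d c (suc m) t =
  trans (identity₁ (t ^ᶻ d) c ((t ^ᶻ d) ^ᶻ suc m) (c ^ᶻ suc m))
    (trans (cong (λ z → t ^ᶻ d * z + c ^ᶻ suc m * (t ^ᶻ d - c)) (powerQuotient-correct d c m t))
           (identity₂ (t ^ᶻ d) c (powerQuotient d c m t) (c ^ᶻ suc m)))
  where
  identity₁ : ∀ x c u v → x * u - c * v ≡ x * (u - v) + v * (x - c)
  identity₁ = solve-∀
  identity₂ : ∀ x c q v → x * ((x - c) * q) + v * (x - c) ≡ (x - c) * (x * q + v)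
  identity₂ = solve-∀

powerQuotient-monic : ∀ e c m → Monic (m ℕ.* suc e) (powerQuotient (suc e) c m)
powerQuotient-monic e c zero = one (λ _ → refl)
powerQuotient-monic e c (suc m) =
  horner _ (c ^ᶻ suc m) (monic-shift e (powerQuotient-monic e c m))
    (λ t → cong (_+ c ^ᶻ suc m) (ℤ.*-assoc t (t ^ᶻ e) _))

module Mod (p : ℕ) (pp : Prime p) where

  P : ℤ
  P = + p

  instance
    p≢0 : ℕ.NonZero p
    p≢0 = prime⇒nonZero pp

  1<p : 1 ℕ.< p
  1<p = ℕ.nonTrivial⇒n>1 p {{prime⇒nonTrivial pp}}

  p-1<p : p ℕ.∸ 1 ℕ.< p
  p-1<p = ℕ.∸-monoʳ-< {p} {1} {0} (s≤s z≤n) (ℕ.<⇒≤ 1<p)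

  euclid : ∀ {x y} → P ∣ x * y → P ∣ x ⊎ P ∣ y
  euclid {x} {y} h with euclidsLemma ℤ.∣ x ∣ ℤ.∣ y ∣ pp (subst (p ℕ∣.∣_) (ℤ.abs-* x y) (∣⇒∣ᵤ h))
  ... | inj₁ d = inj₁ (∣ᵤ⇒∣ d)
  ... | inj₂ d = inj₂ (∣ᵤ⇒∣ d)

  cancel : ∀ {x y} → ¬ P ∣ x → P ∣ x * y → P ∣ y
  cancel P∤x h with euclid h
  ... | inj₁ d = ⊥-elim (P∤x d)
  ... | inj₂ d = d

  ∤-* : ∀ {x y} → ¬ P ∣ x → ¬ P ∣ y → ¬ P ∣ x * y
  ∤-* P∤x P∤y h = P∤y (cancel P∤x h)

  ∤-small : ∀ {n} → 0 ℕ.< n → n ℕ.< p → ¬ P ∣ + n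
  ∤-small {suc n} _ n<p h = ℕ∣.>⇒∤ n<p (∣⇒∣ᵤ h)

  ∣-^ : ∀ {x} n → P ∣ x ^ᶻ n → P ∣ x
  ∣-^ zero h = ⊥-elim (∤-small (s≤s z≤n) 1<p h)
  ∣-^ (suc n) h with euclid h
  ... | inj₁ d = d
  ... | inj₂ d = ∣-^ n d

  residue : ℤ → ℕ
  residue x = x %ℕ p

  residue<p : ∀ x → residue x ℕ.< p
  residue<p x = n%ℕd<d x p

  residue-≡ : ∀ x → P ∣ x - + residue x
  residue-≡ x = divides (x /ℕ p) (trans (cong (_- + residue x) (a≡a%ℕn+[a/ℕn]*n x p))
                                       (identity (+ residue x) ((x /ℕ p) * P)))
    where
    identity : ∀ r q → r + q - r ≡ q
    identity = solve-∀

  open Frobenius (CommutativeRing.commutativeSemiring ℤ.+-*-commutativeRing) using (frobenius-+)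

  open import Algebra.Properties.Semiring.Exp (CommutativeRing.semiring ℤ.+-*-commutativeRing)
    using () renaming (_^_ to _^ˢ_)
  open import Algebra.Properties.Semiring.Mult (CommutativeRing.semiring ℤ.+-*-commutativeRing)
    using () renaming (_×_ to _·_)

  ^ˢ≡^ᶻ : ∀ x n → x ^ˢ n ≡ x ^ᶻ n
  ^ˢ≡^ᶻ x zero = refl
  ^ˢ≡^ᶻ x (suc n) = cong (x *_) (^ˢ≡^ᶻ x n)

  ·≡* : ∀ n x → n · x ≡ + n * x
  ·≡* zero x = sym (ℤ.*-zeroˡ x)
  ·≡* (suc n) x = trans (cong (_+_ x) (·≡* n x)) (sym (ℤ.suc-* (+ n) x))

  [x+1]^p : ∀ x → P ∣ (x + + 1) ^ᶻ p - (x ^ᶻ p + + 1)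
  [x+1]^p x with frobenius-+ pp x (+ 1)
  ... | w , eq rewrite ^ˢ≡^ᶻ (x + + 1) p | ^ˢ≡^ᶻ x p | ^ˢ≡^ᶻ (+ 1) p | 1^ᶻ p | ·≡* p w =
    divides w (trans (cong (_- (x ^ᶻ p + + 1)) eq) (identity (x ^ᶻ p + + 1) P w))
    where
    identity : ∀ u m w → u + m * w - u ≡ w * m
    identity = solve-∀

  0^p : (+ 0) ^ᶻ p ≡ + 0
  0^p = lemma p p≢0
    where
    lemma : ∀ n → ℕ.NonZero n → (+ 0) ^ᶻ n ≡ + 0
    lemma (suc n) _ = ℤ.*-zeroˡ ((+ 0) ^ᶻ n)

  fermat-step : ∀ x y → y ≡ x + + 1 → P ∣ x ^ᶻ p - x → P ∣ y ^ᶻ p - y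
  fermat-step x _ refl h = ∣-lin₂ (+ 1) (+ 1) ([x+1]^p x) h (identity ((x + + 1) ^ᶻ p) (x ^ᶻ p) x)
    where
    identity : ∀ u v x → u - (x + + 1) ≡ + 1 * (u - (v + + 1)) + + 1 * (v - x)
    identity = solve-∀

  fermat-step⁻ : ∀ x y → y ≡ x + + 1 → P ∣ y ^ᶻ p - y → P ∣ x ^ᶻ p - x
  fermat-step⁻ x _ refl h = ∣-lin₂ (- + 1) (+ 1) ([x+1]^p x) h (identity ((x + + 1) ^ᶻ p) (x ^ᶻ p) x)
    where
    identity : ∀ u v x → v - x ≡ - + 1 * (u - (v + + 1)) + + 1 * (u - (x + + 1))
    identity = solve-∀

  -- Induction away from 0 in both directions, since raising to the p-th power commutes with adding
  -- 1 modulo p.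
  fermat : ∀ x → P ∣ x ^ᶻ p - x
  fermat (+ zero) = subst (λ z → P ∣ z - + 0) (sym 0^p) (divides (+ 0) refl)
  fermat (+ suc n) = fermat-step (+ n) (+ suc n) (cong +_ (ℕ.+-comm 1 n)) (fermat (+ n))
  fermat -[1+ zero ] = fermat-step⁻ -[1+ 0 ] (+ 0) refl (fermat (+ 0))
  fermat -[1+ suc n ] = fermat-step⁻ -[1+ suc n ] -[1+ n ] refl (fermat -[1+ n ])

  fermat′ : ∀ x → ¬ P ∣ x → P ∣ x ^ᶻ (p ℕ.∸ 1) - + 1
  fermat′ x P∤x = lemma p refl (fermat x)
    where
    identity : ∀ x u → x * u - x ≡ x * (u - + 1)
    identity = solve-∀
    lemma : ∀ n → p ≡ n → P ∣ x ^ᶻ n - x → P ∣ x ^ᶻ (n ℕ.∸ 1) - + 1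
    lemma zero eq h = ⊥-elim (ℕ.<⇒≢ (ℕ.<-trans (s≤s z≤n) 1<p) (sym eq))
    lemma (suc n) eq h = cancel P∤x (subst (P ∣_) (identity x (x ^ᶻ n)) h)

  inverse : ∀ x → ¬ P ∣ x → ∃ λ y → P ∣ x * y - + 1
  inverse x P∤x = x ^ᶻ (p ℕ.∸ 2) ,
    subst (λ n → P ∣ x ^ᶻ n - + 1) (ℕ.+-∸-assoc 1 {p} {2} 1<p) (fermat′ x P∤x)

  -- Lagrange's bound on the number of roots. Taking the roots to be the segment 1, ..., m keeps the
  -- induction uniform: division by T - m leaves the segment 1, ..., m - 1, on which t - m is
  -- invertible.
  monic-roots : ∀ {n f} → Monic n f → ∀ m → n ℕ.< m → m ℕ.< p →
                ¬ (∀ t → 0 ℕ.< t → t ℕ.≤ m → P ∣ f (+ t))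
  monic-roots (one f≡1) m n<m m<p roots =
    ∤-small (s≤s z≤n) 1<p (subst (P ∣_) (f≡1 (+ m)) (roots m n<m ℕ.≤-refl))
  monic-roots mf@(horner _ _ _ _) (suc m) (s≤s n<m) m<p roots with monic-quotient mf (+ suc m)
  ... | h , mh , hq = monic-roots mh m n<m (ℕ.<-trans (ℕ.n<1+n m) m<p) λ t 0<t t≤m →
    cancel (t-m t t≤m)
      (subst (P ∣_) (hq (+ t))
        (∣m∣n⇒∣m-n (roots t 0<t (ℕ.m≤n⇒m≤1+n t≤m)) (roots (suc m) (s≤s z≤n) ℕ.≤-refl)))
    where
    t-m : ∀ t → t ℕ.≤ m → ¬ P ∣ + t - + suc m
    t-m t t≤m P∣ = ∤-small (ℕ.m<n⇒0<n∸m (s≤s t≤m)) (ℕ.≤-<-trans (ℕ.m∸n≤m (suc m) t) m<p)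
      (subst (P ∣_) (trans (identity (+ t) (+ suc m))
          (trans (ℤ.m-n≡m⊖n (suc m) t) (ℤ.⊖-≥ (ℕ.m≤n⇒m≤1+n t≤m)))) (∣m⇒∣-m P∣))
      where
      identity : ∀ x y → - (x - y) ≡ y - x
      identity = solve-∀

  search : (f : ℤ → ℤ) → (∃ λ t → P ∣ f t) ⊎ (∀ t → t ℕ.< p → ¬ P ∣ f (+ t))
  search f with any? {n = p} (λ i → P ∣? f (+ toℕ i))
  ... | yes (i , h) = inj₁ (+ toℕ i , h)
  ... | no none = inj₂ λ t t<p h →
    none (fromℕ< t<p , subst (λ n → P ∣ f (+ n)) (sym (toℕ-fromℕ< t<p)) h)

  -- Without a root of f, all p - 1 nonzero residues would be roots of q. Only q is counted by
  -- degree, so f enters as a bare function; this serves T^d - c as well as the cubic.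
  root-of-factor : ∀ f {k q} → Monic k q → suc k ℕ.< p →
                   (∀ t → ¬ P ∣ t → P ∣ f t * q t) → ∃ λ t → P ∣ f t
  root-of-factor f {k} mq k<p vanish with search f
  ... | inj₁ root = root
  ... | inj₂ none = ⊥-elim (monic-roots mq (p ℕ.∸ 1) (ℕ.∸-monoˡ-≤ 1 k<p) p-1<p
          λ t 0<t t<p → let t<p = ℕ.≤-<-trans t<p p-1<p in
            cancel (none t t<p) (vanish (+ t) (∤-small 0<t t<p)))

  power-residue : ∀ d m c → d ℕ.* m ≡ p ℕ.∸ 1 → P ∣ c ^ᶻ m - + 1 → ∃ λ t → P ∣ t ^ᶻ d - c
  power-residue zero m c dm h = ⊥-elim (ℕ.<⇒≢ (ℕ.m<n⇒0<n∸m 1<p) dm)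
  power-residue (suc e) zero c dm h =
    ⊥-elim (ℕ.<⇒≢ (ℕ.m<n⇒0<n∸m 1<p) (trans (sym (ℕ.*-zeroʳ (suc e))) dm))
  power-residue d@(suc e) (suc m) c dm h = root-of-factor (λ t → t ^ᶻ d - c)
    (powerQuotient-monic e c m) degree λ t P∤t →
      subst (P ∣_) (powerQuotient-correct d c m t)
        (∣-lin₂ (+ 1) (- + 1) (fermat″ t P∤t) h (identity ((t ^ᶻ d) ^ᶻ suc m) (c ^ᶻ suc m)))
    where
    identity : ∀ u v → u - v ≡ + 1 * (u - + 1) + - + 1 * (v - + 1)
    identity = solve-∀
    fermat″ : ∀ t → ¬ P ∣ t → P ∣ (t ^ᶻ d) ^ᶻ suc m - + 1
    fermat″ t P∤t = subst (λ z → P ∣ z - + 1)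
      (sym (trans (^ᶻ-* t d (suc m)) (cong (t ^ᶻ_) dm))) (fermat′ t P∤t)
    degree : suc (m ℕ.* d) ℕ.< p
    degree = ℕ.≤-<-trans
      (ℕ.≤-trans (s≤s (ℕ.m≤n+m (m ℕ.* d) e)) (ℕ.≤-reflexive (trans (ℕ.*-comm (suc m) d) dm)))
      p-1<p

-- The ring ℤ[X]/(X³ + aX - b)

record Triple : Set where
  constructor ⟨_,_,_⟩
  field
    coeff₀ coeff₁ coeff₂ : ℤ
open Triple

triple-≡ : ∀ {u v : Triple} → coeff₀ u ≡ coeff₀ v → coeff₁ u ≡ coeff₁ v → coeff₂ u ≡ coeff₂ v → u ≡ v
triple-≡ refl refl refl = refl

-- ⟨ u₀ , u₁ , u₂ ⟩ stands for u₀ + u₁ X + u₂ X² in ℤ[X]/(X³ + aX - b).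
module CubicRing (a b : ℤ) where

  infixl 6 _⊕_
  infixl 7 _⊗_

  _⊕_ : Triple → Triple → Triple
  ⟨ u₀ , u₁ , u₂ ⟩ ⊕ ⟨ v₀ , v₁ , v₂ ⟩ = ⟨ u₀ + v₀ , u₁ + v₁ , u₂ + v₂ ⟩

  -- The sums u₁v₂ + u₂v₁ and u₂v₂ are the coefficients of X³ and X⁴, reduced by X³ = b - aX and X⁴
  -- = bX - aX².
  _⊗_ : Triple → Triple → Triple
  ⟨ u₀ , u₁ , u₂ ⟩ ⊗ ⟨ v₀ , v₁ , v₂ ⟩ =
    ⟨ u₀ * v₀ + b * (u₁ * v₂ + u₂ * v₁)
    , u₀ * v₁ + u₁ * v₀ + b * (u₂ * v₂) - a * (u₁ * v₂ + u₂ * v₁)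
    , u₀ * v₂ + u₁ * v₁ + u₂ * v₀ - a * (u₂ * v₂) ⟩

  const : ℤ → Triple
  const c = ⟨ c , + 0 , + 0 ⟩

  X : Triple
  X = ⟨ + 0 , + 1 , + 0 ⟩

  ⊗-comm : ∀ u v → u ⊗ v ≡ v ⊗ u
  ⊗-comm ⟨ u₀ , u₁ , u₂ ⟩ ⟨ v₀ , v₁ , v₂ ⟩ = triple-≡
    (l₀ a b u₀ u₁ u₂ v₀ v₁ v₂) (l₁ a b u₀ u₁ u₂ v₀ v₁ v₂) (l₂ a b u₀ u₁ u₂ v₀ v₁ v₂)
    where
    l₀ : ∀ a b u₀ u₁ u₂ v₀ v₁ v₂ → u₀ * v₀ + b * (u₁ * v₂ + u₂ * v₁) ≡ v₀ * u₀ + b * (v₁ * u₂ + v₂ * u₁)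
    l₀ = solve-∀
    l₁ : ∀ a b u₀ u₁ u₂ v₀ v₁ v₂ → u₀ * v₁ + u₁ * v₀ + b * (u₂ * v₂) - a * (u₁ * v₂ + u₂ * v₁)
       ≡ v₀ * u₁ + v₁ * u₀ + b * (v₂ * u₂) - a * (v₁ * u₂ + v₂ * u₁)
    l₁ = solve-∀
    l₂ : ∀ a b u₀ u₁ u₂ v₀ v₁ v₂ → u₀ * v₂ + u₁ * v₁ + u₂ * v₀ - a * (u₂ * v₂)
       ≡ v₀ * u₂ + v₁ * u₁ + v₂ * u₀ - a * (v₂ * u₂)
    l₂ = solve-∀

  ⊗-distribʳ : ∀ w u v → (u ⊕ v) ⊗ w ≡ u ⊗ w ⊕ v ⊗ w
  ⊗-distribʳ ⟨ w₀ , w₁ , w₂ ⟩ ⟨ u₀ , u₁ , u₂ ⟩ ⟨ v₀ , v₁ , v₂ ⟩ = triple-≡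
    (l₀ b u₀ u₁ u₂ v₀ v₁ v₂ w₀ w₁ w₂) (l₁ a b u₀ u₁ u₂ v₀ v₁ v₂ w₀ w₁ w₂) (l₂ a u₀ u₁ u₂ v₀ v₁ v₂ w₀ w₁ w₂)
    where
    l₀ : ∀ b u₀ u₁ u₂ v₀ v₁ v₂ w₀ w₁ w₂ → (u₀ + v₀) * w₀ + b * ((u₁ + v₁) * w₂ + (u₂ + v₂) * w₁)
       ≡ (u₀ * w₀ + b * (u₁ * w₂ + u₂ * w₁)) + (v₀ * w₀ + b * (v₁ * w₂ + v₂ * w₁))
    l₀ = solve-∀
    l₁ : ∀ a b u₀ u₁ u₂ v₀ v₁ v₂ w₀ w₁ w₂ →
       (u₀ + v₀) * w₁ + (u₁ + v₁) * w₀ + b * ((u₂ + v₂) * w₂) - a * ((u₁ + v₁) * w₂ + (u₂ + v₂) * w₁)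
       ≡ (u₀ * w₁ + u₁ * w₀ + b * (u₂ * w₂) - a * (u₁ * w₂ + u₂ * w₁))
       + (v₀ * w₁ + v₁ * w₀ + b * (v₂ * w₂) - a * (v₁ * w₂ + v₂ * w₁))
    l₁ = solve-∀
    l₂ : ∀ a u₀ u₁ u₂ v₀ v₁ v₂ w₀ w₁ w₂ →
       (u₀ + v₀) * w₂ + (u₁ + v₁) * w₁ + (u₂ + v₂) * w₀ - a * ((u₂ + v₂) * w₂)
       ≡ (u₀ * w₂ + u₁ * w₁ + u₂ * w₀ - a * (u₂ * w₂)) + (v₀ * w₂ + v₁ * w₁ + v₂ * w₀ - a * (v₂ * w₂))
    l₂ = solve-∀

  ⊗-assoc : ∀ u v w → (u ⊗ v) ⊗ w ≡ u ⊗ (v ⊗ w)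
  ⊗-assoc ⟨ u₀ , u₁ , u₂ ⟩ ⟨ v₀ , v₁ , v₂ ⟩ ⟨ w₀ , w₁ , w₂ ⟩ = triple-≡
    (l₀ a b u₀ u₁ u₂ v₀ v₁ v₂ w₀ w₁ w₂) (l₁ a b u₀ u₁ u₂ v₀ v₁ v₂ w₀ w₁ w₂)
        (l₂ a b u₀ u₁ u₂ v₀ v₁ v₂ w₀ w₁ w₂)
    where
    l₀ : ∀ a b u₀ u₁ u₂ v₀ v₁ v₂ w₀ w₁ w₂ →
      let p₀ = u₀ * v₀ + b * (u₁ * v₂ + u₂ * v₁)
          p₁ = u₀ * v₁ + u₁ * v₀ + b * (u₂ * v₂) - a * (u₁ * v₂ + u₂ * v₁)
          p₂ = u₀ * v₂ + u₁ * v₁ + u₂ * v₀ - a * (u₂ * v₂)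
          q₀ = v₀ * w₀ + b * (v₁ * w₂ + v₂ * w₁)
          q₁ = v₀ * w₁ + v₁ * w₀ + b * (v₂ * w₂) - a * (v₁ * w₂ + v₂ * w₁)
          q₂ = v₀ * w₂ + v₁ * w₁ + v₂ * w₀ - a * (v₂ * w₂)
      in p₀ * w₀ + b * (p₁ * w₂ + p₂ * w₁) ≡ u₀ * q₀ + b * (u₁ * q₂ + u₂ * q₁)
    l₀ = solve-∀
    l₁ : ∀ a b u₀ u₁ u₂ v₀ v₁ v₂ w₀ w₁ w₂ →
      let p₀ = u₀ * v₀ + b * (u₁ * v₂ + u₂ * v₁)
          p₁ = u₀ * v₁ + u₁ * v₀ + b * (u₂ * v₂) - a * (u₁ * v₂ + u₂ * v₁)
          p₂ = u₀ * v₂ + u₁ * v₁ + u₂ * v₀ - a * (u₂ * v₂)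
          q₀ = v₀ * w₀ + b * (v₁ * w₂ + v₂ * w₁)
          q₁ = v₀ * w₁ + v₁ * w₀ + b * (v₂ * w₂) - a * (v₁ * w₂ + v₂ * w₁)
          q₂ = v₀ * w₂ + v₁ * w₁ + v₂ * w₀ - a * (v₂ * w₂)
      in p₀ * w₁ + p₁ * w₀ + b * (p₂ * w₂) - a * (p₁ * w₂ + p₂ * w₁)
         ≡ u₀ * q₁ + u₁ * q₀ + b * (u₂ * q₂) - a * (u₁ * q₂ + u₂ * q₁)
    l₁ = solve-∀
    l₂ : ∀ a b u₀ u₁ u₂ v₀ v₁ v₂ w₀ w₁ w₂ →
      let p₀ = u₀ * v₀ + b * (u₁ * v₂ + u₂ * v₁)
          p₁ = u₀ * v₁ + u₁ * v₀ + b * (u₂ * v₂) - a * (u₁ * v₂ + u₂ * v₁)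
          p₂ = u₀ * v₂ + u₁ * v₁ + u₂ * v₀ - a * (u₂ * v₂)
          q₀ = v₀ * w₀ + b * (v₁ * w₂ + v₂ * w₁)
          q₁ = v₀ * w₁ + v₁ * w₀ + b * (v₂ * w₂) - a * (v₁ * w₂ + v₂ * w₁)
          q₂ = v₀ * w₂ + v₁ * w₁ + v₂ * w₀ - a * (v₂ * w₂)
      in p₀ * w₂ + p₁ * w₁ + p₂ * w₀ - a * (p₂ * w₂)
         ≡ u₀ * q₂ + u₁ * q₁ + u₂ * q₀ - a * (u₂ * q₂)
    l₂ = solve-∀

  const-⊗ : ∀ c u → const c ⊗ u ≡ ⟨ c * coeff₀ u , c * coeff₁ u , c * coeff₂ u ⟩
  const-⊗ c ⟨ u₀ , u₁ , u₂ ⟩ = triple-≡ (l₀ b c u₀ u₁ u₂) (l₁ a b c u₀ u₁ u₂) (l₂ a c u₀ u₁ u₂)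
    where
    l₀ : ∀ b c u₀ u₁ u₂ → c * u₀ + b * (+ 0 * u₂ + + 0 * u₁) ≡ c * u₀
    l₀ = solve-∀
    l₁ : ∀ a b c u₀ u₁ u₂ → c * u₁ + + 0 * u₀ + b * (+ 0 * u₂) - a * (+ 0 * u₂ + + 0 * u₁) ≡ c * u₁
    l₁ = solve-∀
    l₂ : ∀ a c u₀ u₁ u₂ → c * u₂ + + 0 * u₁ + + 0 * u₀ - a * (+ 0 * u₂) ≡ c * u₂
    l₂ = solve-∀

  X-⊗ : ∀ u → X ⊗ u ≡ ⟨ b * coeff₂ u , coeff₀ u - a * coeff₂ u , coeff₁ u ⟩
  X-⊗ ⟨ u₀ , u₁ , u₂ ⟩ = triple-≡ (l₀ b u₀ u₁ u₂) (l₁ a b u₀ u₁ u₂) (l₂ a u₀ u₁ u₂)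
    where
    l₀ : ∀ b u₀ u₁ u₂ → + 0 * u₀ + b * (+ 1 * u₂ + + 0 * u₁) ≡ b * u₂
    l₀ = solve-∀
    l₁ : ∀ a b u₀ u₁ u₂ → + 0 * u₁ + + 1 * u₀ + b * (+ 0 * u₂) - a * (+ 1 * u₂ + + 0 * u₁) ≡ u₀ - a * u₂
    l₁ = solve-∀
    l₂ : ∀ a u₀ u₁ u₂ → + 0 * u₂ + + 1 * u₁ + + 0 * u₀ - a * (+ 0 * u₂) ≡ u₁
    l₂ = solve-∀

  ⊗-identityˡ : ∀ u → const (+ 1) ⊗ u ≡ u
  ⊗-identityˡ u = trans (const-⊗ (+ 1) u)
    (triple-≡ (ℤ.*-identityˡ (coeff₀ u)) (ℤ.*-identityˡ (coeff₁ u)) (ℤ.*-identityˡ (coeff₂ u)))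

  ⊗-zeroˡ : ∀ u → const (+ 0) ⊗ u ≡ const (+ 0)
  ⊗-zeroˡ u = trans (const-⊗ (+ 0) u)
    (triple-≡ (ℤ.*-zeroˡ (coeff₀ u)) (ℤ.*-zeroˡ (coeff₁ u)) (ℤ.*-zeroˡ (coeff₂ u)))

  -- The coefficients stay in ℤ with propositional equality, so the generic binomial theorem and
  -- power laws apply directly; congruence modulo p is imposed afterwards as a separate relation.
  commutativeSemiring : CommutativeSemiring 0ℓ 0ℓ
  commutativeSemiring = record
    { Carrier = Triple ; _≈_ = _≡_ ; _+_ = _⊕_ ; _*_ = _⊗_ ; 0# = const (+ 0) ; 1# = const (+ 1)
    ; isCommutativeSemiring = isCommutativeSemiringˡ record
      { +-isCommutativeMonoid = record
        { isMonoid = record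
          { isSemigroup = record
            { isMagma = record { isEquivalence = isEquivalence ; ∙-cong = cong₂ _⊕_ }
            ; assoc = λ u v w → triple-≡ (ℤ.+-assoc (coeff₀ u) (coeff₀ v) (coeff₀ w))
                (ℤ.+-assoc (coeff₁ u) (coeff₁ v) (coeff₁ w)) (ℤ.+-assoc (coeff₂ u) (coeff₂ v) (coeff₂ w)) }
          ; identity = (λ u → triple-≡ (ℤ.+-identityˡ (coeff₀ u)) (ℤ.+-identityˡ (coeff₁ u))
              (ℤ.+-identityˡ (coeff₂ u)))
                     , (λ u → triple-≡ (ℤ.+-identityʳ (coeff₀ u)) (ℤ.+-identityʳ (coeff₁ u))
                         (ℤ.+-identityʳ (coeff₂ u))) }
        ; comm = λ u v → triple-≡ (ℤ.+-comm (coeff₀ u) (coeff₀ v)) (ℤ.+-comm (coeff₁ u) (coeff₁ v))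
            (ℤ.+-comm (coeff₂ u) (coeff₂ v)) }
      ; *-isCommutativeMonoid = record
        { isMonoid = record
          { isSemigroup = record
            { isMagma = record { isEquivalence = isEquivalence ; ∙-cong = cong₂ _⊗_ }
            ; assoc = ⊗-assoc }
          ; identity = ⊗-identityˡ , λ u → trans (⊗-comm u (const (+ 1))) (⊗-identityˡ u) }
        ; comm = ⊗-comm }
      ; distribʳ = ⊗-distribʳ
      ; zeroˡ = ⊗-zeroˡ
      }
    }

  open CommutativeSemiring commutativeSemiring using (semiring)
  open import Algebra.Properties.Semiring.Exp semiring public using () renaming (_^_ to _^³_)
  open import Algebra.Properties.CommutativeSemiring.Exp commutativeSemiring public using () renaming (^-distrib-* to ^³-distrib-⊗)
  open import Algebra.Properties.Semiring.Mult semiring using () renaming (_×_ to _·_)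

  const-^ : ∀ c n → const c ^³ n ≡ const (c ^ᶻ n)
  const-^ c zero = refl
  const-^ c (suc n) = trans (cong (const c ⊗_) (const-^ c n))
    (trans (const-⊗ c (const (c ^ᶻ n))) (cong₂ (λ u v → ⟨ c * c ^ᶻ n , u , v ⟩) (ℤ.*-zeroʳ c) (ℤ.*-zeroʳ c)))

  ·-components : ∀ n u → n · u ≡ ⟨ + n * coeff₀ u , + n * coeff₁ u , + n * coeff₂ u ⟩
  ·-components zero u = sym (triple-≡ (ℤ.*-zeroˡ (coeff₀ u)) (ℤ.*-zeroˡ (coeff₁ u)) (ℤ.*-zeroˡ (coeff₂ u)))
  ·-components (suc n) u = trans (cong (u ⊕_) (·-components n u))
    (sym (triple-≡ (ℤ.suc-* (+ n) (coeff₀ u)) (ℤ.suc-* (+ n) (coeff₁ u)) (ℤ.suc-* (+ n) (coeff₂ u))))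

  eval : Triple → ℤ → ℤ
  eval u t = coeff₀ u + coeff₁ u * t + coeff₂ u * (t * t)

  -- The quotient of T^n by f, whose remainder is `X ^³ n`. Multiplying the remainder by T turns its
  -- X² coefficient into a T³ coefficient, which becomes the next Horner constant of the quotient.
  quotient-X^ : ℕ → ℤ → ℤ
  quotient-X^ zero t = + 0
  quotient-X^ (suc n) t = t * quotient-X^ n t + coeff₂ (X ^³ n)

  division-X^ : ∀ n t → t ^ᶻ n ≡ (t * t * t + a * t - b) * quotient-X^ n t + eval (X ^³ n) t
  division-X^ zero t = identity a b t
    where
    identity : ∀ a b t → + 1 ≡ (t * t * t + a * t - b) * + 0 + (+ 1 + + 0 * t + + 0 * (t * t))
    identity = solve-∀
  division-X^ (suc n) t = trans (cong (t *_) (division-X^ n t))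
    (trans (identity a b t (quotient-X^ n t) (coeff₀ (X ^³ n)) (coeff₁ (X ^³ n)) (coeff₂ (X ^³ n)))
      (cong (λ u → (t * t * t + a * t - b) * quotient-X^ (suc n) t + eval u t) (sym (X-⊗ (X ^³ n)))))
    where
    identity : ∀ a b t q u₀ u₁ u₂ → t * ((t * t * t + a * t - b) * q + (u₀ + u₁ * t + u₂ * (t * t)))
      ≡ (t * t * t + a * t - b) * (t * q + u₂) + (b * u₂ + (u₀ - a * u₂) * t + u₁ * (t * t))
    identity = solve-∀

  coeff₂-X^1 : coeff₂ (X ^³ 1) ≡ + 0
  coeff₂-X^1 = cong coeff₂ (X-⊗ (X ^³ 0))

  coeff₂-X^2 : coeff₂ (X ^³ 2) ≡ + 1
  coeff₂-X^2 = trans (cong coeff₂ (X-⊗ (X ^³ 1))) (trans (cong coeff₁ (X-⊗ (X ^³ 0))) (identity a))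
    where
    identity : ∀ a → + 1 - a * + 0 ≡ + 1
    identity = solve-∀

  quotient-X^-monic : ∀ n → Monic n (quotient-X^ (3 ℕ.+ n))
  quotient-X^-monic zero = one λ t →
    trans (cong₂ (λ y z → t * (t * (t * + 0 + + 0) + y) + z) coeff₂-X^1 coeff₂-X^2) (identity t)
    where
    identity : ∀ t → t * (t * (t * + 0 + + 0) + + 0) + + 1 ≡ + 1
    identity = solve-∀
  quotient-X^-monic (suc n) = horner _ (coeff₂ (X ^³ (3 ℕ.+ n))) (quotient-X^-monic n) (λ _ → refl)

-- Roots of X³ + aX - b modulo p

module CubicMod (p : ℕ) (pp : Prime p) (3<p : 3 ℕ.< p) (a b : ℤ) where
  open Mod p pp
  open CubicRing a b
  open Frobenius commutativeSemiring using (frobenius-+)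

  f : ℤ → ℤ
  f t = t * t * t + a * t - b

  infix 4 _≈_
  record _≈_ (u v : Triple) : Set where
    constructor mod
    field
      mod₀ : P ∣ coeff₀ u - coeff₀ v
      mod₁ : P ∣ coeff₁ u - coeff₁ v
      mod₂ : P ∣ coeff₂ u - coeff₂ v
  open _≈_

  ∣x-x : ∀ x → P ∣ x - x
  ∣x-x x = divides (+ 0) (ℤ.+-inverseʳ x)

  ∣-trans-mod : ∀ x y z → P ∣ x - y → P ∣ y - z → P ∣ x - z
  ∣-trans-mod x y z h k = ∣-lin₂ (+ 1) (+ 1) h k (identity x y z)
    where
    identity : ∀ x y z → x - z ≡ + 1 * (x - y) + + 1 * (y - z)
    identity = solve-∀

  ≈-reflexive : ∀ {u v} → u ≡ v → u ≈ v
  ≈-reflexive {u} refl = mod (∣x-x (coeff₀ u)) (∣x-x (coeff₁ u)) (∣x-x (coeff₂ u))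

  ≈-trans : ∀ {u v w} → u ≈ v → v ≈ w → u ≈ w
  ≈-trans {u} {v} {w} h k = mod
    (∣-trans-mod (coeff₀ u) (coeff₀ v) (coeff₀ w) (mod₀ h) (mod₀ k))
    (∣-trans-mod (coeff₁ u) (coeff₁ v) (coeff₁ w) (mod₁ h) (mod₁ k))
    (∣-trans-mod (coeff₂ u) (coeff₂ v) (coeff₂ w) (mod₂ h) (mod₂ k))

  ≈-sym : ∀ {u v} → u ≈ v → v ≈ u
  ≈-sym {u} {v} h = mod (flip (coeff₀ u) (coeff₀ v) (mod₀ h))
    (flip (coeff₁ u) (coeff₁ v) (mod₁ h)) (flip (coeff₂ u) (coeff₂ v) (mod₂ h))
    where
    identity : ∀ x y → y - x ≡ - + 1 * (x - y)
    identity = solve-∀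
    flip : ∀ x y → P ∣ x - y → P ∣ y - x
    flip x y h = ∣-lin₁ (- + 1) h (identity x y)

  ⊕-cong : ∀ {u u′ v v′} → u ≈ u′ → v ≈ v′ → u ⊕ v ≈ u′ ⊕ v′
  ⊕-cong {u} {u′} {v} {v′} h k = mod
    (∣-lin₂ (+ 1) (+ 1) (mod₀ h) (mod₀ k) (identity (coeff₀ u) (coeff₀ u′) (coeff₀ v) (coeff₀ v′)))
    (∣-lin₂ (+ 1) (+ 1) (mod₁ h) (mod₁ k) (identity (coeff₁ u) (coeff₁ u′) (coeff₁ v) (coeff₁ v′)))
    (∣-lin₂ (+ 1) (+ 1) (mod₂ h) (mod₂ k) (identity (coeff₂ u) (coeff₂ u′) (coeff₂ v) (coeff₂ v′)))
    where
    identity : ∀ x x′ y y′ → (x + y) - (x′ + y′) ≡ + 1 * (x - x′) + + 1 * (y - y′)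
    identity = solve-∀

  ⊗-congˡ : ∀ u {v v′} → v ≈ v′ → u ⊗ v ≈ u ⊗ v′
  ⊗-congˡ ⟨ u₀ , u₁ , u₂ ⟩ {⟨ v₀ , v₁ , v₂ ⟩} {⟨ w₀ , w₁ , w₂ ⟩} h = mod
    (∣-lin₃ u₀ (b * u₂) (b * u₁) (mod₀ h) (mod₁ h) (mod₂ h) (l₀ a b u₀ u₁ u₂ v₀ v₁ v₂ w₀ w₁ w₂))
    (∣-lin₃ u₁ (u₀ - a * u₂) (b * u₂ - a * u₁) (mod₀ h) (mod₁ h) (mod₂ h) (l₁ a b u₀ u₁ u₂ v₀ v₁ v₂ w₀ w₁ w₂))
    (∣-lin₃ u₂ u₁ (u₀ - a * u₂) (mod₀ h) (mod₁ h) (mod₂ h) (l₂ a b u₀ u₁ u₂ v₀ v₁ v₂ w₀ w₁ w₂))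
    where
    l₀ : ∀ a b u₀ u₁ u₂ v₀ v₁ v₂ w₀ w₁ w₂ →
       (u₀ * v₀ + b * (u₁ * v₂ + u₂ * v₁)) - (u₀ * w₀ + b * (u₁ * w₂ + u₂ * w₁))
       ≡ u₀ * (v₀ - w₀) + b * u₂ * (v₁ - w₁) + b * u₁ * (v₂ - w₂)
    l₀ = solve-∀
    l₁ : ∀ a b u₀ u₁ u₂ v₀ v₁ v₂ w₀ w₁ w₂ →
       (u₀ * v₁ + u₁ * v₀ + b * (u₂ * v₂) - a * (u₁ * v₂ + u₂ * v₁))
       - (u₀ * w₁ + u₁ * w₀ + b * (u₂ * w₂) - a * (u₁ * w₂ + u₂ * w₁))
       ≡ u₁ * (v₀ - w₀) + (u₀ - a * u₂) * (v₁ - w₁) + (b * u₂ - a * u₁) * (v₂ - w₂)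
    l₁ = solve-∀
    l₂ : ∀ a b u₀ u₁ u₂ v₀ v₁ v₂ w₀ w₁ w₂ →
       (u₀ * v₂ + u₁ * v₁ + u₂ * v₀ - a * (u₂ * v₂)) - (u₀ * w₂ + u₁ * w₁ + u₂ * w₀ - a * (u₂ * w₂))
       ≡ u₂ * (v₀ - w₀) + u₁ * (v₁ - w₁) + (u₀ - a * u₂) * (v₂ - w₂)
    l₂ = solve-∀

  frobenius-⊕ : ∀ u v → (u ⊕ v) ^³ p ≈ u ^³ p ⊕ v ^³ p
  frobenius-⊕ u v with frobenius-+ pp u v
  ... | w , eq = ≈-trans (≈-reflexive (trans eq (cong ((u ^³ p ⊕ v ^³ p) ⊕_) (·-components p w))))
    (mod (multiple (coeff₀ (u ^³ p ⊕ v ^³ p)) (coeff₀ w))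
         (multiple (coeff₁ (u ^³ p ⊕ v ^³ p)) (coeff₁ w))
         (multiple (coeff₂ (u ^³ p ⊕ v ^³ p)) (coeff₂ w)))
    where
    identity : ∀ x m w → (x + m * w) - x ≡ w * m
    identity = solve-∀
    multiple : ∀ x w → P ∣ (x + P * w) - x
    multiple x w = divides w (identity x P w)

  frobenius-const : ∀ c → const c ^³ p ≈ const c
  frobenius-const c = ≈-trans (≈-reflexive (const-^ c p)) (mod (fermat c) (∣x-x (+ 0)) (∣x-x (+ 0)))

  frobenius-const-⊗ : ∀ c u → (const c ⊗ u) ^³ p ≈ const c ⊗ u ^³ p
  frobenius-const-⊗ c u = ≈-trans
      (≈-reflexive (trans (^³-distrib-⊗ (const c) u p) (⊗-comm (const c ^³ p) (u ^³ p))))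
    (≈-trans (⊗-congˡ (u ^³ p) (frobenius-const c)) (≈-reflexive (⊗-comm (u ^³ p) (const c))))

  Y : Triple
  Y = X ^³ p

  A B C : ℤ
  A = coeff₂ Y
  B = coeff₁ Y
  C = coeff₀ Y

  X³+aX≡b : X ⊗ (X ⊗ X) ⊕ const a ⊗ X ≡ const b
  X³+aX≡b = trans (cong₂ _⊕_ (trans (cong (X ⊗_) (X-⊗ X)) (X-⊗ ⟨ b * + 0 , + 0 - a * + 0 , + 1 ⟩))
      (const-⊗ a X))
    (triple-≡ (l₀ a b) (l₁ a b) (l₂ a))
    where
    l₀ : ∀ a b → b * + 1 + a * + 0 ≡ b
    l₀ = solve-∀
    l₁ : ∀ a b → b * + 0 - a * + 1 + a * + 1 ≡ + 0
    l₁ = solve-∀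
    l₂ : ∀ a → (+ 0 - a * + 0) + a * + 0 ≡ + 0
    l₂ = solve-∀

  Y³+aY≈b : Y ⊗ (Y ⊗ Y) ⊕ const a ⊗ Y ≈ const b
  Y³+aY≈b = ≈-trans
    (⊕-cong (≈-reflexive (sym (trans (^³-distrib-⊗ X (X ⊗ X) p) (cong (Y ⊗_) (^³-distrib-⊗ X X p)))))
            (≈-sym (frobenius-const-⊗ a X)))
    (≈-trans (≈-sym (frobenius-⊕ (X ⊗ (X ⊗ X)) (const a ⊗ X)))
      (≈-trans (≈-reflexive (cong (_^³ p) X³+aX≡b)) (frobenius-const b)))

  ∣-0 : ∀ {x} → P ∣ x → P ∣ x - + 0
  ∣-0 {x} = subst (P ∣_) (sym (ℤ.+-identityʳ x))

  ∣-0⁻ : ∀ {x} → P ∣ x - + 0 → P ∣ x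
  ∣-0⁻ {x} = subst (P ∣_) (ℤ.+-identityʳ x)

  zero₀ : ∀ {u} → u ≈ const (+ 0) → P ∣ coeff₀ u
  zero₀ h = ∣-0⁻ (mod₀ h)

  zero₁ : ∀ {u} → u ≈ const (+ 0) → P ∣ coeff₁ u
  zero₁ h = ∣-0⁻ (mod₁ h)

  zero₂ : ∀ {u} → u ≈ const (+ 0) → P ∣ coeff₂ u
  zero₂ h = ∣-0⁻ (mod₂ h)

  ⊗-zero : ∀ u {v} → v ≈ const (+ 0) → u ⊗ v ≈ const (+ 0)
  ⊗-zero u h = ≈-trans (⊗-congˡ u h)
    (≈-reflexive (trans (⊗-comm u (const (+ 0))) (⊗-zeroˡ u)))

  -- Y² + XY + X² + a for Y = ⟨ C , B , A ⟩: the cofactor of Y - X in Y³ + aY - b.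
  cofactor : ℤ → ℤ → ℤ → Triple
  cofactor C B A =
    ⟨ A * b * (+ 2 * B + + 1) + C * C + a
    , (+ 2 * B + + 1) * (C - a * A) + b * (A * A)
    , B * B + B + + 1 + + 2 * A * C - a * (A * A) ⟩

  -- Since X is itself a root of f in this ring, Y³ + aY - b = f(Y) - f(X) is divisible by Y - X.
  -- The constant b is moved to the other side because triples carry no subtraction.
  cofactor-⊗ : ∀ C B A → ⟨ C , B - + 1 , A ⟩ ⊗ cofactor C B A ⊕ const b
    ≡ ⟨ C , B , A ⟩ ⊗ (⟨ C , B , A ⟩ ⊗ ⟨ C , B , A ⟩) ⊕ const a ⊗ ⟨ C , B , A ⟩
  cofactor-⊗ C B A = trans (triple-≡ (l₀ a b A B C) (l₁ a b A B C) (l₂ a b A B C))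
      (cong (⟨ C , B , A ⟩ ⊗ (⟨ C , B , A ⟩ ⊗ ⟨ C , B , A ⟩) ⊕_) (sym (const-⊗ a ⟨ C , B , A ⟩)))
    where
    l₀ : ∀ a b A B C →
      let n₀ = A * b * (+ 2 * B + + 1) + C * C + a
          n₁ = (+ 2 * B + + 1) * (C - a * A) + b * (A * A)
          n₂ = B * B + B + + 1 + + 2 * A * C - a * (A * A)
          s₀ = C * C + b * (B * A + A * B)
          s₁ = C * B + B * C + b * (A * A) - a * (B * A + A * B)
          s₂ = C * A + B * B + A * C - a * (A * A)
      in C * n₀ + b * ((B - + 1) * n₂ + A * n₁) + b ≡ C * s₀ + b * (B * s₂ + A * s₁) + a * C
    l₀ = solve-∀
    l₁ : ∀ a b A B C →
      let n₀ = A * b * (+ 2 * B + + 1) + C * C + a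
          n₁ = (+ 2 * B + + 1) * (C - a * A) + b * (A * A)
          n₂ = B * B + B + + 1 + + 2 * A * C - a * (A * A)
          s₀ = C * C + b * (B * A + A * B)
          s₁ = C * B + B * C + b * (A * A) - a * (B * A + A * B)
          s₂ = C * A + B * B + A * C - a * (A * A)
      in C * n₁ + (B - + 1) * n₀ + b * (A * n₂) - a * ((B - + 1) * n₂ + A * n₁) + + 0
         ≡ C * s₁ + B * s₀ + b * (A * s₂) - a * (B * s₂ + A * s₁) + a * B
    l₁ = solve-∀
    l₂ : ∀ a b A B C →
      let n₀ = A * b * (+ 2 * B + + 1) + C * C + a
          n₁ = (+ 2 * B + + 1) * (C - a * A) + b * (A * A)
          n₂ = B * B + B + + 1 + + 2 * A * C - a * (A * A)
          s₀ = C * C + b * (B * A + A * B)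
          s₁ = C * B + B * C + b * (A * A) - a * (B * A + A * B)
          s₂ = C * A + B * B + A * C - a * (A * A)
      in C * n₂ + (B - + 1) * n₁ + A * n₀ - a * (A * n₂) + + 0
         ≡ C * s₂ + B * s₁ + A * s₀ - a * (A * s₂) + a * A
    l₂ = solve-∀

  cofactor-zero : ⟨ C , B - + 1 , A ⟩ ⊗ cofactor C B A ≈ const (+ 0)
  cofactor-zero = ⊕-cancel (≈-trans (≈-reflexive (cofactor-⊗ C B A)) Y³+aY≈b)
    where
    identity : ∀ x c → x - + 0 ≡ + 1 * (x + c - c)
    identity = solve-∀
    ⊕-cancel : ∀ {u v} → u ⊕ v ≈ v → u ≈ const (+ 0)
    ⊕-cancel {u} {v} h = mod (∣-lin₁ (+ 1) (mod₀ h) (identity (coeff₀ u) (coeff₀ v)))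
      (∣-lin₁ (+ 1) (mod₁ h) (identity (coeff₁ u) (coeff₁ v)))
      (∣-lin₁ (+ 1) (mod₂ h) (identity (coeff₂ u) (coeff₂ v)))

  module NoRoot (no-root : ∀ t → ¬ P ∣ f t) where

    -- The form is v³f(u/v): a zero with v invertible would make u/v a root of f, and for v ≡ 0 only
    -- u³ remains.
    homogeneous : ∀ u v → P ∣ u * u * u + a * u * (v * v) - b * (v * v * v) → P ∣ u × P ∣ v
    homogeneous u v h with P ∣? v
    ... | yes P∣v = ∣-^ 3 (∣-lin₂ (+ 1) (b * (v * v) - a * u * v) h P∣v (identity a b u v)) , P∣v
      where
      identity : ∀ a b u v → u * (u * (u * + 1))
          ≡ + 1 * (u * u * u + a * u * (v * v) - b * (v * v * v)) + (b * (v * v) - a * u * v) * v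
      identity = solve-∀
    ... | no P∤v with inverse v P∤v
    ... | i , vi≡1 = ⊥-elim (no-root (u * i)
      (∣-lin₂ (i * i * i) (b * (v * v * i * i + v * i + + 1) - a * u * i * (v * i + + 1)) h vi≡1
        (identity a b u v i)))
      where
      identity : ∀ a b u v i → u * i * (u * i) * (u * i) + a * (u * i) - b
        ≡ i * i * i * (u * u * u + a * u * (v * v) - b * (v * v * v))
        + (b * (v * v * i * i + v * i + + 1) - a * u * i * (v * i + + 1)) * (v * i - + 1)
      identity = solve-∀

    -- The norm N of c + dX is the form of `homogeneous` at (c, -d), hence invertible unless c and d
    -- both vanish modulo p. Multiplication by the adjugate `q` turns the product (c + dX)v into Nv.
    linear-factor : ∀ c d v → ⟨ c , d , + 0 ⟩ ⊗ v ≈ const (+ 0) →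
                    (P ∣ c × P ∣ d) ⊎ v ≈ const (+ 0)
    linear-factor c d v h with P ∣? (c * c * c + a * c * (- d * - d) - b * (- d * - d * - d))
    ... | yes N≡0 with homogeneous c (- d) N≡0
    ... | P∣c , P∣-d = inj₁ (P∣c , subst (P ∣_) (ℤ.neg-involutive d) (∣m⇒∣-m P∣-d))
    linear-factor c d v h | no N≢0 = inj₂ (mod (∣-0 (cancel N≢0 (zero₀ Nv)))
        (∣-0 (cancel N≢0 (zero₁ Nv))) (∣-0 (cancel N≢0 (zero₂ Nv))))
      where
      N : ℤ
      N = c * c * c + a * c * (- d * - d) - b * (- d * - d * - d)
      q : Triple
      q = ⟨ c * c + a * (d * d) , - (c * d) , d * d ⟩
      norm : q ⊗ ⟨ c , d , + 0 ⟩ ≡ const N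
      norm = triple-≡ (l₀ a b c d) (l₁ a b c d) (l₂ a c d)
        where
        l₀ : ∀ a b c d → (c * c + a * (d * d)) * c + b * (- (c * d) * + 0 + d * d * d)
           ≡ c * c * c + a * c * (- d * - d) - b * (- d * - d * - d)
        l₀ = solve-∀
        l₁ : ∀ a b c d → (c * c + a * (d * d)) * d + - (c * d) * c + b * (d * d * + 0) - a * (- (c * d) * + 0 + d * d * d) ≡ + 0
        l₁ = solve-∀
        l₂ : ∀ a c d → (c * c + a * (d * d)) * + 0 + - (c * d) * d + d * d * c - a * (d * d * + 0) ≡ + 0
        l₂ = solve-∀
      Nv : ⟨ N * coeff₀ v , N * coeff₁ v , N * coeff₂ v ⟩ ≈ const (+ 0)
      Nv = ≈-trans (≈-reflexive (trans (sym (const-⊗ N v))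
          (trans (cong (_⊗ v) (sym norm)) (⊗-assoc q ⟨ c , d , + 0 ⟩ v))))
                   (⊗-zero q h)

    -- One step of Euclid's algorithm on f and u: the factor u₂X - u₁ cancels the X² term of u and
    -- leaves ρ₀ + ρ₁X, to which `linear-factor` applies. If that vanishes, u is a constant modulo
    -- p.
    domain : ∀ u v → u ⊗ v ≈ const (+ 0) → u ≈ const (+ 0) ⊎ v ≈ const (+ 0)
    domain u@(⟨ u₀ , u₁ , u₂ ⟩) v h = [ constant , inj₂ ]′ (linear-factor ρ₀ ρ₁ v reduced)
      where
      ρ₀ ρ₁ : ℤ
      ρ₀ = b * (u₂ * u₂) - u₀ * u₁
      ρ₁ = u₀ * u₂ - u₁ * u₁ - a * (u₂ * u₂)

      reduce : ⟨ - u₁ , u₂ , + 0 ⟩ ⊗ u ≡ ⟨ ρ₀ , ρ₁ , + 0 ⟩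
      reduce = triple-≡ (l₀ b u₀ u₁ u₂) (l₁ a b u₀ u₁ u₂) (l₂ a u₀ u₁ u₂)
        where
        l₀ : ∀ b u₀ u₁ u₂ → - u₁ * u₀ + b * (u₂ * u₂ + + 0 * u₁) ≡ b * (u₂ * u₂) - u₀ * u₁
        l₀ = solve-∀
        l₁ : ∀ a b u₀ u₁ u₂ → - u₁ * u₁ + u₂ * u₀ + b * (+ 0 * u₂) - a * (u₂ * u₂ + + 0 * u₁)
           ≡ u₀ * u₂ - u₁ * u₁ - a * (u₂ * u₂)
        l₁ = solve-∀
        l₂ : ∀ a u₀ u₁ u₂ → - u₁ * u₂ + u₂ * u₁ + + 0 * u₀ - a * (+ 0 * u₂) ≡ + 0
        l₂ = solve-∀

      reduced : ⟨ ρ₀ , ρ₁ , + 0 ⟩ ⊗ v ≈ const (+ 0)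
      reduced = ≈-trans
        (≈-reflexive (trans (cong (_⊗ v) (sym reduce)) (⊗-assoc ⟨ - u₁ , u₂ , + 0 ⟩ u v)))
        (⊗-zero ⟨ - u₁ , u₂ , + 0 ⟩ h)

      -- This combination of ρ₀ and ρ₁ eliminates u₀ and leaves the form of `homogeneous` at (u₁,
      -- u₂).
      identity : ∀ a b u₀ u₁ u₂ → u₁ * u₁ * u₁ + a * u₁ * (u₂ * u₂) - b * (u₂ * u₂ * u₂)
        ≡ - u₂ * (b * (u₂ * u₂) - u₀ * u₁) + - u₁ * (u₀ * u₂ - u₁ * u₁ - a * (u₂ * u₂))
      identity = solve-∀

      constant : P ∣ ρ₀ × P ∣ ρ₁ → u ≈ const (+ 0) ⊎ v ≈ const (+ 0)
      constant (P∣ρ₀ , P∣ρ₁) =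
        Sum.map₁ (λ P∣u₀ → mod (∣-0 (proj₁ P∣u₀)) (∣-0 P∣u₁) (∣-0 P∣u₂))
          (linear-factor u₀ (+ 0) v (≈-trans (≈-sym lower) h))
        where
        P∣u₁,₂ : P ∣ u₁ × P ∣ u₂
        P∣u₁,₂ = homogeneous u₁ u₂ (∣-lin₂ (- u₂) (- u₁) P∣ρ₀ P∣ρ₁ (identity a b u₀ u₁ u₂))
        P∣u₁ : P ∣ u₁
        P∣u₁ = proj₁ P∣u₁,₂
        P∣u₂ : P ∣ u₂
        P∣u₂ = proj₂ P∣u₁,₂
        lower : u ⊗ v ≈ ⟨ u₀ , + 0 , + 0 ⟩ ⊗ v
        lower = ≈-trans (≈-reflexive (⊗-comm u v)) (≈-trans
          (⊗-congˡ v (mod (∣x-x u₀) (∣-0 P∣u₁) (∣-0 P∣u₂)))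
          (≈-reflexive (⊗-comm v ⟨ u₀ , + 0 , + 0 ⟩)))

  P∤3 : ¬ P ∣ + 3
  P∤3 = ∤-small (s≤s z≤n) 3<p

  P∤2 : ¬ P ∣ + 2
  P∤2 = ∤-small (s≤s z≤n) (ℕ.<-trans (ℕ.n<1+n 2) 3<p)

  P∤9 : ¬ P ∣ + 9
  P∤9 = ∤-* P∤3 P∤3

  criterion : ℤ
  criterion = (- + 4 * (a * a * a) - + 27 * (b * b)) * (A * A) - + 9 * (a * a)

  module Rootless (no-root : ∀ t → ¬ P ∣ f t) where
    open NoRoot no-root

    -- If the remainder of T^p by f were T, then by Fermat f times a monic quotient of degree p - 3
    -- would vanish at every residue, and counting the roots of that quotient would give f a root.
    Y≉X : ¬ ⟨ C , B - + 1 , A ⟩ ≈ const (+ 0)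
    Y≉X (mod h₀ h₁ h₂) = no-root (proj₁ root) (proj₂ root)
      where
      identity : ∀ f q u₀ u₁ u₂ t v → v ≡ f * q + (u₀ + u₁ * t + u₂ * (t * t)) →
        f * q ≡ + 1 * (v - t) + (- t * (u₁ - + 1) + - (t * t) * u₂ + - + 1 * u₀)
      identity f q u₀ u₁ u₂ t _ refl = lemma f q u₀ u₁ u₂ t
        where
        lemma : ∀ f q u₀ u₁ u₂ t → f * q ≡ + 1 * (f * q + (u₀ + u₁ * t + u₂ * (t * t)) - t)
          + (- t * (u₁ - + 1) + - (t * t) * u₂ + - + 1 * u₀)
        lemma = solve-∀
      degree : 3 ℕ.+ (p ℕ.∸ 3) ≡ p
      degree = ℕ.m+[n∸m]≡n (ℕ.<⇒≤ 3<p)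
      vanish : ∀ t → P ∣ f t * quotient-X^ p t
      vanish t = subst (P ∣_) (sym (identity (f t) (quotient-X^ p t) C B A t (t ^ᶻ p) (division-X^ p t)))
        (∣m∣n⇒∣m+n (∣n⇒∣m*n (+ 1) (fermat t))
          (∣-lin₃ (- t) (- (t * t)) (- + 1) (∣-0⁻ h₁) (∣-0⁻ h₂) (∣-0⁻ h₀) refl))
      root : ∃ λ t → P ∣ f t
      root = root-of-factor f (subst (λ n → Monic (p ℕ.∸ 3) (quotient-X^ n)) degree
          (quotient-X^-monic (p ℕ.∸ 3)))
        (subst (suc (p ℕ.∸ 3) ℕ.<_) degree (ℕ.m≤n+m (2 ℕ.+ (p ℕ.∸ 3)) 1)) (λ t _ → vanish t)

    cofactor≈0 : cofactor C B A ≈ const (+ 0)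
    cofactor≈0 = [ ⊥-elim ∘ Y≉X , id ]′ (domain ⟨ C , B - + 1 , A ⟩ (cofactor C B A) cofactor-zero)

    -- The traces of 1, X, X² are 3, 0, -2a, so δ = 3C - 2aA is the trace of Y; the second factor is
    -- Aδ + 1. The combination of the three cofactor coordinates is chosen to eliminate both b and
    -- 2B + 1.
    trace-or-root : P ∣ (+ 3 * C - + 2 * a * A) * (+ 3 * A * C - + 2 * a * (A * A) + + 1)
    trace-or-root = ∣-lin₃ A (- (+ 2 * B + + 1)) (+ 4 * (C - a * A))
      (zero₀ cofactor≈0) (zero₁ cofactor≈0) (zero₂ cofactor≈0) (identity a b A B C)
      where
      identity : ∀ a b A B C → (+ 3 * C - + 2 * a * A) * (+ 3 * A * C - + 2 * a * (A * A) + + 1)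
        ≡ A * (A * b * (+ 2 * B + + 1) + C * C + a)
        + - (+ 2 * B + + 1) * ((+ 2 * B + + 1) * (C - a * A) + b * (A * A))
        + + 4 * (C - a * A) * (B * B + B + + 1 + + 2 * A * C - a * (A * A))
      identity = solve-∀

    -- In this case -(2B + 1)/A would be a root.
    trace≢ : ¬ P ∣ + 3 * A * C - + 2 * a * (A * A) + + 1
    trace≢ κ≡0 = ∤-small (s≤s z≤n) 1<p (∣-lin₂ (+ 1) (- (+ 3 * C - + 2 * a * A)) κ≡0 P∣A (identity₂ a A C))
      where
      identity : ∀ a b A B C → let E = + 2 * B + + 1 in + 3 * (E * E * E + a * E * (- A * - A) - b * (- A * - A * - A))
        ≡ + 12 * E * (B * B + B + + 1 + + 2 * A * C - a * (A * A))
        + - + 9 * E * (+ 3 * A * C - + 2 * a * (A * A) + + 1)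
        + + 3 * A * (E * (C - a * A) + b * (A * A))
      identity = solve-∀
      identity₂ : ∀ a A C → + 1 ≡ + 1 * (+ 3 * A * C - + 2 * a * (A * A) + + 1) + - (+ 3 * C - + 2 * a * A) * A
      identity₂ = solve-∀
      P∣A : P ∣ A
      P∣A = subst (P ∣_) (ℤ.neg-involutive A) (∣m⇒∣-m (proj₂ (homogeneous (+ 2 * B + + 1) (- A)
        (cancel P∤3 (∣-lin₃ (+ 12 * (+ 2 * B + + 1)) (- + 9 * (+ 2 * B + + 1)) (+ 3 * A)
          (zero₂ cofactor≈0) κ≡0 (zero₁ cofactor≈0) (identity a b A B C))))))

    -- Put E = 2B + 1. With trace zero, 3C ≡ 2aA turns the X coordinate of the cofactor into A(3bA -
    -- aE)/3, and substituting aAE ≡ 3bA² into -9a times the constant coordinate produces the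
    -- criterion.
    rootless⇒criterion : P ∣ criterion
    rootless⇒criterion = [ from-trace , ⊥-elim ∘ trace≢ ]′ (euclid trace-or-root)
      where
      identity : ∀ a b A B C → let E = + 2 * B + + 1 ; δ = + 3 * C - + 2 * a * A in
        (- + 4 * (a * a * a) - + 27 * (b * b)) * (A * A) - + 9 * (a * a)
        ≡ - (+ 9 * a) * (A * b * E + C * C + a) + (+ 9 * b * E + a * δ + + 4 * (a * a * A)) * δ
        + - (+ 27 * b) * (E * (C - a * A) + b * (A * A))
      identity = solve-∀
      from-trace : P ∣ + 3 * C - + 2 * a * A → P ∣ criterion
      from-trace δ≡0 = ∣-lin₃ (- (+ 9 * a))
          (+ 9 * b * (+ 2 * B + + 1) + a * (+ 3 * C - + 2 * a * A) + + 4 * (a * a * A)) (- (+ 27 * b))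
        (zero₀ cofactor≈0) δ≡0 (zero₁ cofactor≈0) (identity a b A B C)

  -- Y is the remainder of T^p by f, so at a root of f its value is t^p, which is t by Fermat.
  eval-Y : ∀ t → P ∣ f t → P ∣ eval Y t - t
  eval-Y t ft = ∣-lin₂ (+ 1) (- quotient-X^ p t) (fermat t) ft
    (identity (f t) (quotient-X^ p t) (eval Y t) t (t ^ᶻ p) (division-X^ p t))
    where
    identity : ∀ f q e t v → v ≡ f * q + e → e - t ≡ + 1 * (v - t) + - q * f
    identity f q e t _ refl = lemma f q e t
      where
      lemma : ∀ f q e t → e - t ≡ + 1 * (f * q + e - t) + - q * f
      lemma = solve-∀

  module Root (P∤a : ¬ P ∣ a) (P∤b : ¬ P ∣ b) (r : ℤ) (fr : P ∣ f r) where

    -- Modulo p, f = (T - r)g with g = T² + rT + s, and `disc` is the discriminant of g. Replacing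
    -- X² by -rX - s in C + BX + AX² gives αX + β.
    s disc α β : ℤ
    s = r * r + a
    disc = r * r - + 4 * s
    α = B - A * r
    β = C - A * s

    g : Triple → Triple
    g u = (u ⊗ u ⊕ const r ⊗ u) ⊕ const s

    X-r : Triple
    X-r = ⟨ - r , + 1 , + 0 ⟩

    g[Y]≈g[X]^p : g X ^³ p ≈ g Y
    g[Y]≈g[X]^p = ≈-trans (frobenius-⊕ (X ⊗ X ⊕ const r ⊗ X) (const s))
      (⊕-cong (≈-trans (frobenius-⊕ (X ⊗ X) (const r ⊗ X))
                (⊕-cong (≈-reflexive (^³-distrib-⊗ X X p)) (frobenius-const-⊗ r X)))
              (frobenius-const s))

    [X-r]g[X]≈0 : X-r ⊗ g X ≈ const (+ 0)
    [X-r]g[X]≈0 = ≈-trans (≈-reflexive (trans (cong (X-r ⊗_) gX) product))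
                    (mod (∣-lin₁ (- + 1) fr (identity a b r)) (∣x-x (+ 0)) (∣x-x (+ 0)))
      where
      identity : ∀ a b r → (b - r * (r * r + a)) - + 0 ≡ - + 1 * (r * r * r + a * r - b)
      identity = solve-∀
      gX : g X ≡ ⟨ s , r , + 1 ⟩
      gX = trans (cong₂ (λ u v → (u ⊕ v) ⊕ const s) (X-⊗ X) (const-⊗ r X))
          (triple-≡ (l₀ a b r) (l₁ a r) (l₂ r))
        where
        l₀ : ∀ a b r → b * + 0 + r * + 0 + (r * r + a) ≡ r * r + a
        l₀ = solve-∀
        l₁ : ∀ a r → + 0 - a * + 0 + r * + 1 + + 0 ≡ r
        l₁ = solve-∀
        l₂ : ∀ r → + 1 + r * + 0 + + 0 ≡ + 1
        l₂ = solve-∀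
      product : X-r ⊗ ⟨ s , r , + 1 ⟩ ≡ const (b - r * s)
      product = triple-≡ (l₀ a b r) (l₁ a b r) (l₂ a r)
        where
        l₀ : ∀ a b r → - r * (r * r + a) + b * (+ 1 * + 1 + + 0 * r) ≡ b - r * (r * r + a)
        l₀ = solve-∀
        l₁ : ∀ a b r → - r * r + + 1 * (r * r + a) + b * (+ 0 * + 1) - a * (+ 1 * + 1 + + 0 * r) ≡ + 0
        l₁ = solve-∀
        l₂ : ∀ a r → - r * + 1 + + 1 * r + + 0 * (r * r + a) - a * (+ 0 * + 1) ≡ + 0
        l₂ = solve-∀

    -- This expresses g(Y) ≡ 0 modulo g: multiplication by X - r embeds 𝔽_p[X]/(g) into 𝔽_p[X]/(f)
    -- as the ideal generated by X - r. It holds because g(Y) ≡ g(X)^p contains a factor g(X), and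
    -- (X - r)g(X) = f(X) up to a multiple of p.
    [X-r]g[Y]≈0 : X-r ⊗ g Y ≈ const (+ 0)
    [X-r]g[Y]≈0 = ≈-trans (⊗-congˡ X-r (≈-sym g[Y]≈g[X]^p)) (annihilate p p≢0)
      where
      annihilate : ∀ n → ℕ.NonZero n → X-r ⊗ g X ^³ n ≈ const (+ 0)
      annihilate (suc n) _ = ≈-trans
        (≈-reflexive (trans (sym (⊗-assoc X-r (g X) (g X ^³ n))) (⊗-comm (X-r ⊗ g X) (g X ^³ n))))
        (⊗-zero (g X ^³ n) [X-r]g[X]≈0)

    gY≈0 : X-r ⊗ ((Y ⊗ Y ⊕ ⟨ r * C , r * B , r * A ⟩) ⊕ const s) ≈ const (+ 0)
    gY≈0 = ≈-trans (≈-reflexive (cong (λ u → X-r ⊗ ((Y ⊗ Y ⊕ u) ⊕ const s)) (sym (const-⊗ r Y)))) [X-r]g[Y]≈0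

    -- Y ≡ αX + β modulo g, so the two coefficients of g(αX + β) modulo g vanish.
    α-equation : P ∣ α * (+ 2 * β + r - α * r)
    α-equation = ∣-lin₂ (+ 1) (A * A) (zero₂ gY≈0) fr (identity a b r A B C)
      where
      identity : ∀ a b r A B C →
        let s = r * r + a ; α = B - A * r ; β = C - A * s
            g₀ = C * C + b * (B * A + A * B) + r * C + s
            g₁ = C * B + B * C + b * (A * A) - a * (B * A + A * B) + r * B + + 0
            g₂ = C * A + B * B + A * C - a * (A * A) + r * A + + 0
        in α * (+ 2 * β + r - α * r) ≡ + 1 * (- r * g₂ + + 1 * g₁ + + 0 * g₀ - a * (+ 0 * g₂))
           + A * A * (r * r * r + a * r - b)
      identity = solve-∀

    β-equation : P ∣ β * β + r * β + s - α * α * s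
    β-equation = ∣-lin₃ (+ 1) r (+ 2 * A * B) (zero₁ gY≈0) (zero₂ gY≈0) fr (identity a b r A B C)
      where
      identity : ∀ a b r A B C →
        let s = r * r + a ; α = B - A * r ; β = C - A * s
            g₀ = C * C + b * (B * A + A * B) + r * C + s
            g₁ = C * B + B * C + b * (A * A) - a * (B * A + A * B) + r * B + + 0
            g₂ = C * A + B * B + A * C - a * (A * A) + r * A + + 0
        in β * β + r * β + s - α * α * s
           ≡ + 1 * (- r * g₁ + + 1 * g₀ + b * (+ 0 * g₂) - a * (+ 1 * g₂ + + 0 * g₁))
           + r * (- r * g₂ + + 1 * g₁ + + 0 * g₀ - a * (+ 0 * g₂))
           + + 2 * A * B * (r * r * r + a * r - b)
      identity = solve-∀

    P∤9a² : ¬ P ∣ + 9 * (a * a)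
    P∤9a² = ∤-* P∤9 (∤-* P∤a P∤a)

    f′[r] : ℤ
    f′[r] = + 3 * (r * r) + a

    module Criterion (D≡ : P ∣ criterion) where

      -- The discriminant of f is disc * f′(r)².
      P∤disc*f′² : ¬ P ∣ disc * (f′[r] * f′[r])
      P∤disc*f′² h = P∤9a² (∣-lin₃ (- + 1) (A * A) (A * A * (+ 27 * (b + r * s))) D≡ h fr (identity a b r A))
        where
        identity : ∀ a b r A → let s = r * r + a ; f′ = + 3 * (r * r) + a in
          + 9 * (a * a) ≡ - + 1 * ((- + 4 * (a * a * a) - + 27 * (b * b)) * (A * A) - + 9 * (a * a))
          + A * A * ((r * r - + 4 * s) * (f′ * f′)) + A * A * (+ 27 * (b + r * s)) * (r * r * r + a * r - b)
        identity = solve-∀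

      P∤disc : ¬ P ∣ disc
      P∤disc h = P∤disc*f′² (∣m⇒∣m*n (f′[r] * f′[r]) h)

      -- The remainder αX + β takes the value r - τ at r, and γ is the second factor in
      -- `α-equation`.
      τ γ : ℤ
      τ = r - α * r - β
      γ = + 2 * β + r - α * r

      -- τ = f′(r) A, because Y(r) = r.
      disc*τ²≡9a² : P ∣ disc * (τ * τ) - + 9 * (a * a)
      disc*τ²≡9a² = ∣-lin₃ (+ 1) (- (A * A * (+ 27 * (b + r * s)))) (- (disc * (f′[r] * A + τ)))
              D≡ fr (eval-Y r fr) (identity a b r A B C)
        where
        identity : ∀ a b r A B C →
          let s = r * r + a ; disc = r * r - + 4 * s ; α = B - A * r ; β = C - A * s
              f′ = + 3 * (r * r) + a ; τ = r - α * r - β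
          in disc * (τ * τ) - + 9 * (a * a)
            ≡ + 1 * ((- + 4 * (a * a * a) - + 27 * (b * b)) * (A * A) - + 9 * (a * a))
            + - (A * A * (+ 27 * (b + r * s))) * (r * r * r + a * r - b)
            + - (disc * (f′ * A + τ)) * (C + B * r + A * (r * r) - r)
        identity = solve-∀

      -- If Frobenius is constant modulo g, then the two roots β and -r - β of g coincide.
      P∤α : ¬ P ∣ α
      P∤α α≡0 = P∤disc (∣-lin₃ (+ 2 * β + r) (- + 4) (- + 4 * α * s) 2β+r≡0 β-equation α≡0
                  (identity₃ r s α β))
        where
        β′ : ℤ
        β′ = - r - β
        identity₁ : ∀ a b r α β → let s = r * r + a ; β′ = - r - β in
          β′ * β′ * β′ + a * β′ - b
          ≡ (β′ - r) * (β * β + r * β + s - α * α * s) + (β′ - r) * (α * s) * α + + 1 * (r * r * r + a * r - b)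
        identity₁ = solve-∀
        identity₂ : ∀ a r A B C → let s = r * r + a ; α = B - A * r ; β = C - A * s ; β′ = - r - β in
          + 2 * β + r ≡ + 1 * (C + B * β′ + A * (β′ * β′) - β′)
          + - A * (β * β + r * β + s - α * α * s) + - (A * (α * s) + β′) * α
        identity₂ = solve-∀
        identity₃ : ∀ r s α β → r * r - + 4 * s ≡ (+ 2 * β + r) * (+ 2 * β + r)
          + - + 4 * (β * β + r * β + s - α * α * s) + - + 4 * α * s * α
        identity₃ = solve-∀
        -- For α ≡ 0, Y takes the value β at every root of g. Its value at the root β′ = -r - β is
        -- also β′ by `eval-Y`, so β ≡ β′.
        2β+r≡0 : P ∣ + 2 * β + r
        2β+r≡0 = ∣-lin₃ (+ 1) (- A) (- (A * (α * s) + β′))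
          (eval-Y β′ (∣-lin₃ (β′ - r) ((β′ - r) * (α * s)) (+ 1) β-equation α≡0 fr (identity₁ a b r α β)))
          β-equation α≡0 (identity₂ a r A B C)

      γ≡0 : P ∣ γ
      γ≡0 = cancel P∤α α-equation

      -- Completing the square in `β-equation` with 2β + r ≡ αr gives (α² - 1) · disc ≡ 0.
      α²≡1 : P ∣ (α - + 1) * (α + + 1)
      α²≡1 = cancel P∤disc (∣-lin₂ (+ 4) (- (+ 2 * β + r + α * r)) β-equation γ≡0 (identity r s α β))
        where
        identity : ∀ r s α β → (r * r - + 4 * s) * ((α - + 1) * (α + + 1))
          ≡ + 4 * (β * β + r * β + s - α * α * s) + - (+ 2 * β + r + α * r) * (+ 2 * β + r - α * r)
        identity = solve-∀

      P∤4 : ¬ P ∣ + 4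
      P∤4 = ∤-* P∤2 P∤2

      -- Here γ ≡ 0 yields β ≡ 0 and then τ ≡ 0, which leaves 9a² ≡ 0.
      α≢1 : ¬ P ∣ α - + 1
      α≢1 h = ∤-* P∤4 P∤9a² (∣-lin₃ (- + 4) (disc * (+ 2 * τ) * - (+ 3 * r)) (- (disc * (+ 2 * τ)))
                disc*τ²≡9a² h γ≡0 (identity a disc r α β))
        where
        identity : ∀ a disc r α β → let τ = r - α * r - β in
          + 4 * (+ 9 * (a * a)) ≡ - + 4 * (disc * (τ * τ) - + 9 * (a * a))
          + disc * (+ 2 * τ) * - (+ 3 * r) * (α - + 1) + - (disc * (+ 2 * τ)) * (+ 2 * β + r - α * r)
        identity = solve-∀

      -- Here β ≡ -r and τ ≡ 3r, and disc · 9r² - 9a² = -9 f′(r) s. Neither factor vanishes: f′(r)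
      -- divides the discriminant of f modulo p, and rs ≡ b.
      α≢-1 : ¬ P ∣ α + + 1
      α≢-1 h = ∤-* (∤-* P∤4 P∤9) (∤-* P∤f′ P∤s)
          (∣-lin₃ (- + 4) (- (disc * (+ 2 * τ + + 6 * r) * (+ 3 * r))) (- (disc * (+ 2 * τ + + 6 * r)))
            disc*τ²≡9a² h γ≡0 (identity a r α β))
        where
        identity : ∀ a r α β → let s = r * r + a ; disc = r * r - + 4 * s ; τ = r - α * r - β in
          + 4 * + 9 * ((+ 3 * (r * r) + a) * s) ≡ - + 4 * (disc * (τ * τ) - + 9 * (a * a))
          + - (disc * (+ 2 * τ + + 6 * r) * (+ 3 * r)) * (α + + 1) + - (disc * (+ 2 * τ + + 6 * r)) * (+ 2 * β + r - α * r)
        identity = solve-∀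
        P∤f′ : ¬ P ∣ f′[r]
        P∤f′ k = P∤disc*f′² (∣n⇒∣m*n disc (∣n⇒∣m*n f′[r] k))
        P∤s : ¬ P ∣ s
        P∤s k = P∤b (∣-lin₂ r (- + 1) k fr (identity₂ a b r))
          where
          identity₂ : ∀ a b r → b ≡ r * (r * r + a) + - + 1 * (r * r * r + a * r - b)
          identity₂ = solve-∀

      absurd : ⊥
      absurd = [ α≢1 , α≢-1 ]′ (euclid α²≡1)

    root⇒¬criterion : ¬ P ∣ criterion
    root⇒¬criterion D≡ = Criterion.absurd D≡

  f-mod : ∀ x y → P ∣ x - y → P ∣ f y → P ∣ f x
  f-mod x y h k = ∣-lin₂ (x * x + x * y + y * y + a) (+ 1) h k (identity a b x y)
    where
    identity : ∀ a b x y → x * x * x + a * x - b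
      ≡ (x * x + x * y + y * y + a) * (x - y) + + 1 * (y * y * y + a * y - b)
    identity = solve-∀

  ¬criterion⇒root : ¬ P ∣ criterion → ∃ λ t → P ∣ f t
  ¬criterion⇒root D≢ with search f
  ... | inj₁ root = root
  ... | inj₂ none = ⊥-elim (D≢ (Rootless.rootless⇒criterion λ t ft →
          none (residue t) (residue<p t)
            (f-mod (+ residue t) t (subst (P ∣_) (identity t (+ residue t)) (∣m⇒∣-m (residue-≡ t))) ft)))
    where
    identity : ∀ x y → - (x - y) ≡ y - x
    identity = solve-∀

  root-nonzero : ¬ P ∣ b → ∀ t → P ∣ f t → ¬ P ∣ t
  root-nonzero P∤b t ft P∣t = P∤b (∣-lin₂ (t * t + a) (- + 1) P∣t ft (identity a b t))
    where
    identity : ∀ a b t → b ≡ (t * t + a) * t + - + 1 * (t * t * t + a * t - b)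
    identity = solve-∀

  -- If r is a double root then -2r is the third root.
  simple-root : ¬ P ∣ b → ∀ r → P ∣ f r → ∃ λ t → P ∣ f t × ¬ P ∣ + 3 * (t * t) + a
  simple-root P∤b r fr with P ∣? + 3 * (r * r) + a
  ... | no f′r≢0 = r , fr , f′r≢0
  ... | yes f′r≡0 = - (+ 2 * r) , ∣-lin₂ (+ 1) (- (+ 3 * r)) fr f′r≡0 (identity₁ a b r) ,
          λ h → ∤-* P∤9 (∤-* P∤r P∤r) (∣-lin₂ (+ 1) (- + 1) h f′r≡0 (identity₂ a r))
    where
    P∤r : ¬ P ∣ r
    P∤r = root-nonzero P∤b r fr
    identity₁ : ∀ a b r → let t = - (+ 2 * r) in
      t * t * t + a * t - b ≡ + 1 * (r * r * r + a * r - b) + - (+ 3 * r) * (+ 3 * (r * r) + a)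
    identity₁ = solve-∀
    identity₂ : ∀ a r → let t = - (+ 2 * r) in
      + 9 * (r * r) ≡ + 1 * (+ 3 * (t * t) + a) + - + 1 * (+ 3 * (r * r) + a)
    identity₂ = solve-∀

-- The sequence u as coefficients of powers of X

module Useq (a₀ b₀ : ℕ) where
  open CubicRing (+ a₀) (+ b₀)

  private
    a b : ℤ
    a = + a₀
    b = + b₀

  coeff₂-X^ : ∀ n → coeff₂ (X ^³ (3 ℕ.+ n)) ≡ b * coeff₂ (X ^³ n) - a * coeff₂ (X ^³ suc n)
  coeff₂-X^ n = trans (cong coeff₂ (X-⊗ (X ^³ (2 ℕ.+ n))))
    (trans (cong coeff₁ (X-⊗ (X ^³ (1 ℕ.+ n))))
      (cong (λ u → coeff₀ u - a * coeff₂ (X ^³ (1 ℕ.+ n))) (X-⊗ (X ^³ n))))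

  -- Both sides satisfy the recurrence coming from X³ = b - aX. Run from the X² coefficients 0, 0, 1
  -- of 1, X, X², it produces the prescribed u₁, u₂, u₃; the shift of the exponent by two is why
  -- u_{p-2} belongs to X^p.
  useq-X^ : ∀ n → useq a₀ b₀ (suc n) ≡ coeff₂ (X ^³ (3 ℕ.+ n))
  useq-X^ 0 = sym (trans (coeff₂-X^ 0) (trans (cong (λ z → b * + 0 - a * z) coeff₂-X^1) (identity a b)))
    where
    identity : ∀ a b → b * + 0 - a * + 0 ≡ + 0
    identity = solve-∀
  useq-X^ 1 = sym (trans (coeff₂-X^ 1)
      (trans (cong₂ (λ y z → b * y - a * z) coeff₂-X^1 coeff₂-X^2) (identity a b)))
    where
    identity : ∀ a b → b * + 0 - a * + 1 ≡ - a
    identity = solve-∀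
  useq-X^ 2 = sym (trans (coeff₂-X^ 2)
      (trans (cong₂ (λ y z → b * y - a * z) coeff₂-X^2 (sym (useq-X^ 0))) (identity a b)))
    where
    identity : ∀ a b → b * + 1 - a * + 0 ≡ b
    identity = solve-∀
  useq-X^ (suc (suc (suc n))) = sym (trans (coeff₂-X^ (3 ℕ.+ n))
    (cong₂ (λ y z → b * y - a * z) (sym (useq-X^ n)) (sym (useq-X^ (suc n)))))

module Condition (p : ℕ) (pp : Prime p) (3<p : 3 ℕ.< p) (a₀ b₀ : ℕ) where
  open Mod p pp
  open CubicRing (+ a₀) (+ b₀)
  open CubicMod p pp 3<p (+ a₀) (+ b₀)
  open Useq a₀ b₀

  useq-p∸2 : useq a₀ b₀ (p ℕ.∸ 2) ≡ A
  useq-p∸2 = trans (cong (useq a₀ b₀) (ℕ.+-∸-assoc 1 {p} {3} (ℕ.<⇒≤ 3<p)))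
    (trans (useq-X^ (p ℕ.∸ 3)) (cong (λ n → coeff₂ (X ^³ n)) (ℕ.m+[n∸m]≡n (ℕ.<⇒≤ 3<p))))

  criterion≡ : D₀ a₀ b₀ * useq a₀ b₀ (p ℕ.∸ 2) ^ᶻ 2 - + 9 * (+ a₀) ^ᶻ 2 ≡ criterion
  criterion≡ = trans (cong (λ u → D₀ a₀ b₀ * u ^ᶻ 2 - + 9 * (+ a₀) ^ᶻ 2) useq-p∸2) (identity (+ a₀) (+ b₀) A)
    where
    identity : ∀ a b u → (- + 4 * (a * (a * (a * + 1))) - + 27 * (b * (b * + 1))) * (u * (u * + 1)) - + 9 * (a * (a * + 1))
      ≡ (- + 4 * (a * a * a) - + 27 * (b * b)) * (u * u) - + 9 * (a * a)
    identity = solve-∀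

  condD⇒simple-root : ¬ P ∣ + b₀ → CondD p a₀ b₀ → ∃ λ t → P ∣ f t × ¬ P ∣ + 3 * (t * t) + + a₀
  condD⇒simple-root P∤b D≢ =
    let r , fr = ¬criterion⇒root (λ h → D≢ (∣⇒∣ᵤ (subst (P ∣_) (sym criterion≡) h))) in simple-root P∤b r fr

  root⇒condD : ¬ P ∣ + a₀ → ¬ P ∣ + b₀ → ∀ r → P ∣ f r → CondD p a₀ b₀
  root⇒condD P∤a P∤b r fr D≡ = Root.root⇒¬criterion P∤a P∤b r fr (subst (P ∣_) criterion≡ (∣ᵤ⇒∣ D≡))

-- Squares and cubes modulo p

module PowerResidues (p : ℕ) (pp : Prime p) (3<p : 3 ℕ.< p) where
  open Mod p pp

  instance
    gcd≢0 : ℕ.NonZero (gcd 3 (p ℕ.∸ 1))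
    gcd≢0 = ℕ.≢-nonZero (gcd[m,n]≢0 3 (p ℕ.∸ 1) (inj₁ (λ ())))

  1+[p-1]≡p : suc (p ℕ.∸ 1) ≡ p
  1+[p-1]≡p = ℕ.m+[n∸m]≡n (ℕ.<⇒≤ 1<p)

  -- c^m ≡ t^(dm) = (t^(p-1))^k ≡ 1. The multiple k covers cubes when gcd(3, p - 1) = 1, where the
  -- exponent is p - 1 itself and k = 3.
  power⇒residue : ∀ e m k c → let d = suc e in d ℕ.* m ≡ (p ℕ.∸ 1) ℕ.* k → ¬ P ∣ c →
                  ∀ t → P ∣ t ^ᶻ d - c → P ∣ c ^ᶻ m - + 1
  power⇒residue e m k c dm P∤c t h = ∣-lin₂ (- + 1) (+ 1) (^ᶻ-mod (t ^ᶻ d) c m h) t^dm≡1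
      (identity ((t ^ᶻ d) ^ᶻ m) (c ^ᶻ m))
    where
    d : ℕ
    d = suc e
    identity : ∀ u v → v - + 1 ≡ - + 1 * (u - v) + + 1 * (u - + 1)
    identity = solve-∀
    P∤t : ¬ P ∣ t
    P∤t P∣t = P∤c (∣-lin₂ (t ^ᶻ e) (- + 1) P∣t h (identity₂ t (t ^ᶻ e) c))
      where
      identity₂ : ∀ t u c → c ≡ u * t + - + 1 * (t * u - c)
      identity₂ = solve-∀
    t^dm≡1 : P ∣ (t ^ᶻ d) ^ᶻ m - + 1
    t^dm≡1 = subst (λ z → P ∣ z - + 1)
      (trans (^ᶻ-* t (p ℕ.∸ 1) k) (trans (cong (t ^ᶻ_) (sym dm)) (sym (^ᶻ-* t d m))))
      (subst (λ z → P ∣ (t ^ᶻ (p ℕ.∸ 1)) ^ᶻ k - z) (1^ᶻ k) (^ᶻ-mod (t ^ᶻ (p ℕ.∸ 1)) (+ 1) k (fermat′ t P∤t)))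

  ∤p : ∀ {d} → 1 ℕ.< d → d ℕ.< p → ¬ d ℕ∣.∣ p
  ∤p 1<d d<p d∣p with prime⇒irreducible pp d∣p
  ... | inj₁ d≡1 = ℕ.<⇒≢ 1<d (sym d≡1)
  ... | inj₂ d≡p = ℕ.<⇒≢ d<p d≡p

  even-or-odd : ∀ n → 2 ℕ∣.∣ n ⊎ 2 ℕ∣.∣ suc n
  even-or-odd zero = inj₁ (ℕ∣._∣0 2)
  even-or-odd (suc n) with even-or-odd n
  ... | inj₁ (ℕ∣.divides q refl) = inj₂ (ℕ∣.divides (suc q) refl)
  ... | inj₂ h = inj₁ h

  mod-3 : ∀ n → 3 ℕ∣.∣ n ⊎ 3 ℕ∣.∣ suc n ⊎ 3 ℕ∣.∣ suc (suc n)
  mod-3 zero = inj₁ (ℕ∣._∣0 3)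
  mod-3 (suc n) with mod-3 n
  ... | inj₁ (ℕ∣.divides q refl) = inj₂ (inj₂ (ℕ∣.divides (suc q) refl))
  ... | inj₂ (inj₁ h) = inj₁ h
  ... | inj₂ (inj₂ h) = inj₂ (inj₁ h)

  2*[p-1]/2 : 2 ℕ.* ((p ℕ.∸ 1) / 2) ≡ p ℕ.∸ 1
  2*[p-1]/2 with even-or-odd (p ℕ.∸ 1)
  ... | inj₁ h = m*[n/m]≡n h
  ... | inj₂ h = ⊥-elim (∤p (s≤s (s≤s z≤n)) (ℕ.<-trans (ℕ.n<1+n 2) 3<p) (subst (2 ℕ∣.∣_) 1+[p-1]≡p h))

  euler⇒square : ∀ c → P ∣ c ^ᶻ ((p ℕ.∸ 1) / 2) - + 1 → ∃ λ t → P ∣ t ^ᶻ 2 - c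
  euler⇒square c = power-residue 2 ((p ℕ.∸ 1) / 2) c 2*[p-1]/2

  square⇒euler : ∀ c → ¬ P ∣ c → ∀ t → P ∣ t ^ᶻ 2 - c → P ∣ c ^ᶻ ((p ℕ.∸ 1) / 2) - + 1
  square⇒euler c = power⇒residue 1 ((p ℕ.∸ 1) / 2) 1 c (trans 2*[p-1]/2 (sym (ℕ.*-identityʳ _)))

  g : ℕ
  g = gcd 3 (p ℕ.∸ 1)

  g*cubeExp : g ℕ.* cubeExp p ≡ p ℕ.∸ 1
  g*cubeExp = m*[n/m]≡n (gcd[m,n]∣n 3 (p ℕ.∸ 1))

  g≡1⊎g≡3 : g ≡ 1 ⊎ g ≡ 3
  g≡1⊎g≡3 = prime⇒irreducible (from-yes (prime? 3)) (gcd[m,n]∣m 3 (p ℕ.∸ 1))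

  -- Here p = 3k + 2, and c = c^(2p - 1) is the cube of c^(2k + 1).
  cube-of-everything : g ≡ 1 → ∀ c → ∃ λ t → P ∣ t ^ᶻ 3 - c
  cube-of-everything g≡1 c with mod-3 (p ℕ.∸ 1)
  ... | inj₁ h = ⊥-elim (ℕ∣.>⇒∤ (s≤s (s≤s z≤n)) (subst (3 ℕ∣.∣_) g≡1 (gcd-greatest ℕ∣.∣-refl h)))
  ... | inj₂ (inj₁ h) = ⊥-elim (∤p (s≤s (s≤s z≤n)) 3<p (subst (3 ℕ∣.∣_) 1+[p-1]≡p h))
  ... | inj₂ (inj₂ (ℕ∣.divides (suc k) eq)) = c ^ᶻ (2 ℕ.* k ℕ.+ 1) ,
      subst (λ z → P ∣ z - c) (sym exponent)
          (∣-lin₂ (c ^ᶻ (p ℕ.∸ 1)) (+ 1) (fermat c) (fermat c) (identity c (c ^ᶻ (p ℕ.∸ 1)) (c ^ᶻ p) c^p))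
    where
    c^p : c ^ᶻ p ≡ c * c ^ᶻ (p ℕ.∸ 1)
    c^p = cong (c ^ᶻ_) (sym 1+[p-1]≡p)
    p-1 : p ℕ.∸ 1 ≡ 3 ℕ.* k ℕ.+ 1
    p-1 = ℕ.+-cancelˡ-≡ 2 _ _ (trans eq (arith k))
      where
      arith : ∀ k → suc k ℕ.* 3 ≡ 2 ℕ.+ (3 ℕ.* k ℕ.+ 1)
      arith = solve-∀ℕ
    exponent : (c ^ᶻ (2 ℕ.* k ℕ.+ 1)) ^ᶻ 3 ≡ c ^ᶻ (p ℕ.∸ 1) * c ^ᶻ p
    exponent = trans (^ᶻ-* c (2 ℕ.* k ℕ.+ 1) 3)
      (trans (cong (c ^ᶻ_) (trans (arith k) (cong₂ ℕ._+_ (sym p-1) (trans (cong suc (sym p-1)) 1+[p-1]≡p))))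
             (^ᶻ-+ c (p ℕ.∸ 1) p))
      where
      arith : ∀ k → (2 ℕ.* k ℕ.+ 1) ℕ.* 3 ≡ (3 ℕ.* k ℕ.+ 1) ℕ.+ suc (3 ℕ.* k ℕ.+ 1)
      arith = solve-∀ℕ
    identity : ∀ c u v → v ≡ c * u → u * v - c ≡ u * (v - c) + + 1 * (v - c)
    identity c u _ refl = lemma c u
      where
      lemma : ∀ c u → u * (c * u) - c ≡ u * (c * u - c) + + 1 * (c * u - c)
      lemma = solve-∀

  euler⇒cube : ∀ c → P ∣ c ^ᶻ cubeExp p - + 1 → ∃ λ t → P ∣ t ^ᶻ 3 - c
  euler⇒cube c h with g≡1⊎g≡3
  ... | inj₁ g≡1 = cube-of-everything g≡1 c
  ... | inj₂ g≡3 = power-residue 3 (cubeExp p) c (trans (cong (ℕ._* cubeExp p) (sym g≡3)) g*cubeExp) h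

  cube⇒euler : ∀ c → ¬ P ∣ c → ∀ t → P ∣ t ^ᶻ 3 - c → P ∣ c ^ᶻ cubeExp p - + 1
  cube⇒euler c P∤c = power⇒residue 2 (cubeExp p) k c exponent P∤c
    where
    k : ℕ
    k = ℕ∣.quotient (gcd[m,n]∣m 3 (p ℕ.∸ 1))
    exponent : 3 ℕ.* cubeExp p ≡ (p ℕ.∸ 1) ℕ.* k
    exponent = trans (cong (ℕ._* cubeExp p) (ℕ∣._∣_.equality (gcd[m,n]∣m 3 (p ℕ.∸ 1))))
      (trans (ℕ.*-assoc k g (cubeExp p)) (trans (cong (k ℕ.*_) g*cubeExp) (ℕ.*-comm k _)))

-- Hensel lifting

module Hensel (p : ℕ) (pp : Prime p) where
  open Mod p pp

  infix 9 P^_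
  P^_ : ℕ → ℤ
  P^ n = P ^ᶻ n

  trunc-coherent : ∀ d n → P^ n ∣ trunc p d (suc n) - trunc p d n
  trunc-coherent d n = divides (+ d n) (identity (trunc p d n) (+ d n * P^ n))
    where
    identity : ∀ t x → t + x - t ≡ x
    identity = solve-∀

  trunc-1 : ∀ d → trunc p d 1 ≡ + d 0
  trunc-1 d = identity (+ d 0)
    where
    identity : ∀ x → + 0 + x * + 1 ≡ x
    identity = solve-∀

  -- The coefficients β and γ are p-adic integers given by coherent truncations; the coefficient of
  -- x³ is a power of p in the application, hence a fixed integer.
  module Lift (α : ℤ) (β γ : ℕ → ℤ)
              (β-coherent : ∀ n → P^ n ∣ β (suc n) - β n)
              (γ-coherent : ∀ n → P^ n ∣ γ (suc n) - γ n)
              (r : ℤ) (P∤r : ¬ P ∣ r)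
              (root : P ∣ α * (r * r * r) + β 1 * r - γ 1)
              (simple : ¬ P ∣ + 3 * α * (r * r) + β 1) where

    G : ℕ → ℤ → ℤ
    G n x = α * (x * x * x) + β n * x - γ n

    slope : ℤ
    slope = + 3 * α * (r * r) + β 1

    ι : ℤ
    ι = proj₁ (inverse slope simple)

    -- Level n works modulo p^(n+1), so level 0 already holds the first digit. `near` keeps the
    -- derivative congruent to `slope`, so that one inverse ι serves all levels.
    record Approximation (n : ℕ) : Set where
      constructor approximation
      field
        value : ℤ
        vanishes : P^ suc n ∣ G (suc n) value
        near : P ∣ value - r
    open Approximation

    β-mod-P : ∀ n → P ∣ β (suc n) - β 1
    β-mod-P zero = divides (+ 0) (ℤ.+-inverseʳ (β 1))
    β-mod-P (suc n) = ∣-lin₂ (+ 1) (+ 1) (∣-trans (∣m⇒∣m*n (P^ n) ∣-refl) (β-coherent (suc n))) (β-mod-P n)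
        (identity (β (suc (suc n))) (β (suc n)) (β 1))
      where
      identity : ∀ x y z → x - z ≡ + 1 * (x - y) + + 1 * (y - z)
      identity = solve-∀

    start : Approximation 0
    start = approximation (+ residue r)
      (subst (_∣ G 1 (+ residue r)) (sym (ℤ.*-identityʳ P))
        (∣-lin₂ (+ 1) (- (α * (r * r + r * + residue r + + residue r * + residue r) + β 1)) root (residue-≡ r)
          (identity₁ α (β 1) (γ 1) r (+ residue r))))
      (∣-lin₁ (- + 1) (residue-≡ r) (identity₂ r (+ residue r)))
      where
      identity₁ : ∀ α β γ r x → α * (x * x * x) + β * x - γ
        ≡ + 1 * (α * (r * r * r) + β * r - γ) + - (α * (r * r + r * x + x * x) + β) * (r - x)
      identity₁ = solve-∀
      identity₂ : ∀ r x → x - r ≡ - + 1 * (r - x)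
      identity₂ = solve-∀

    module Step (n : ℕ) (a : Approximation n) where
      x q : ℤ
      x = value a
      q = P^ suc n

      -- Advancing the coefficients to the next truncation changes them by multiples of q, so the
      -- old value remains a root modulo q.
      refined : q ∣ G (suc (suc n)) x
      refined = ∣-lin₃ (+ 1) x (- + 1) (vanishes a) (β-coherent (suc n)) (γ-coherent (suc n))
        (identity α (β (suc n)) (β (suc (suc n))) (γ (suc n)) (γ (suc (suc n))) x)
        where
        identity : ∀ α β β′ γ γ′ x → α * (x * x * x) + β′ * x - γ′
          ≡ + 1 * (α * (x * x * x) + β * x - γ) + x * (β′ - β) + - + 1 * (γ′ - γ)
        identity = solve-∀

      k : ℤ
      k = quotient refined

      -- With G(x) = kq, the value G(x + dq) is q(k + dG′(x)) modulo pq; Newton's correction is thus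
      -- d ≡ -k/G′(x), and G′(x) ≡ `slope`.
      digitℕ : ℕ
      digitℕ = residue (- (k * ι))

      d : ℤ
      d = + digitℕ

      newton : P ∣ k + d * (+ 3 * α * (x * x) + β (suc (suc n)))
      newton = subst (P ∣_) (sym (identity α (β 1) (β (suc (suc n))) r x k d ι))
        (∣m∣n⇒∣m+n
          (∣-lin₃ (- slope) (- k) (d * (+ 3 * α * (x + r))) (residue-≡ (- (k * ι)))
              (proj₂ (inverse slope simple)) (near a) refl)
          (∣n⇒∣m*n d (β-mod-P (suc n))))
        where
        identity : ∀ α β β′ r x k d ι → let s = + 3 * α * (r * r) + β in
          k + d * (+ 3 * α * (x * x) + β′)
          ≡ - s * (- (k * ι) - d) + - k * (s * ι - + 1) + d * (+ 3 * α * (x + r)) * (x - r) + d * (β′ - β)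
        identity = solve-∀

      next : Approximation (suc n)
      next = approximation (x + d * q)
        -- The second and third order Taylor terms are multiples of q², which pq divides because q
        -- contains a factor p.
        (∣-lin₂ (+ 1) (+ 3 * α * x * (d * d) + α * (d * d * d) * q)
          (P*q∣q* newton)
          (P*q∣q* {q} (∣m⇒∣m*n (P^ n) ∣-refl))
          (identity α (β (suc (suc n))) (γ (suc (suc n))) x d q k (_∣_.equality refined)))
        (∣-lin₂ (+ 1) (d * P^ n) (near a) ∣-refl (identity₂ x d P (P^ n) r))
        where
        P*q∣q* : ∀ {z} → P ∣ z → P * q ∣ q * z
        P*q∣q* {z} P∣z = subst (_∣ q * z) (ℤ.*-comm q P) (*-monoʳ-∣ q P∣z)
        identity₂ : ∀ x d P q r → x + d * (P * q) - r ≡ + 1 * (x - r) + d * q * P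
        identity₂ = solve-∀
        identity : ∀ α β γ x d q k → α * (x * x * x) + β * x - γ ≡ k * q →
          α * ((x + d * q) * (x + d * q) * (x + d * q)) + β * (x + d * q) - γ
          ≡ + 1 * (q * (k + d * (+ 3 * α * (x * x) + β))) + (+ 3 * α * x * (d * d) + α * (d * d * d) * q) * (q * q)
        identity α β γ x d q k eq = trans (expand α β γ x d q)
            (trans (cong (_+ (d * q * (+ 3 * α * (x * x) + β) + (+ 3 * α * x * (d * d) + α * (d * d * d) * q) * (q * q))) eq) (collect α β x d q k))
          where
          expand : ∀ α β γ x d q → α * ((x + d * q) * (x + d * q) * (x + d * q)) + β * (x + d * q) - γ
            ≡ (α * (x * x * x) + β * x - γ) + (d * q * (+ 3 * α * (x * x) + β) + (+ 3 * α * x * (d * d) + α * (d * d * d) * q) * (q * q))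
          expand = solve-∀
          collect : ∀ α β x d q k → k * q + (d * q * (+ 3 * α * (x * x) + β) + (+ 3 * α * x * (d * d) + α * (d * d * d) * q) * (q * q))
            ≡ + 1 * (q * (k + d * (+ 3 * α * (x * x) + β))) + (+ 3 * α * x * (d * d) + α * (d * d * d) * q) * (q * q)
          collect = solve-∀

    approximate : ∀ n → Approximation n
    approximate zero = start
    approximate (suc n) = Step.next n (approximate n)

    digits : ℕ → ℕ
    digits zero = residue r
    digits (suc n) = Step.digitℕ n (approximate n)

    -- Each correction is d · p^(n+1) with 0 ≤ d < p, which is a term of a digit expansion; the
    -- truncations therefore equal the approximations instead of being merely congruent to them.
    trunc-digits : ∀ n → trunc p digits (suc n) ≡ value (approximate n)
    trunc-digits zero = trunc-1 digits
    trunc-digits (suc n) = cong (_+ (+ digits (suc n)) * P^ suc n) (trunc-digits n)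

    lift : Unit p
    lift = mkUnit digits digits<p λ r≡0 → P∤r
        (subst (P ∣_) (trans (cong (λ n → r - + n) r≡0) (ℤ.+-identityʳ r)) (residue-≡ r))
      where
      digits<p : ∀ n → digits n ℕ.< p
      digits<p zero = residue<p r
      digits<p (suc n) = residue<p (- (Step.k n (approximate n) * ι))

    lift-root : ∀ n → P^ n ∣ G n (trunc p digits n)
    lift-root zero = divides (G 0 (+ 0)) (sym (ℤ.*-identityʳ (G 0 (+ 0))))
    lift-root (suc n) = subst (λ x → P^ suc n ∣ G (suc n) x) (sym (trunc-digits n)) (vanishes (approximate n))

-- Solutions of prescribed valuation

module Local (p : ℕ) (pp : Prime p) (3<p : 3 ℕ.< p) (a b : Qp× p) where
  open Mod p pp
  open PowerResidues p pp 3<p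
  open Hensel p pp
  open Condition p pp 3<p (c₀ a) (c₀ b)
  open CubicMod p pp 3<p (+ c₀ a) (+ c₀ b) using (P∤3; P∤2; root-nonzero)

  A₀ B₀ Ā₀ : ℤ
  A₀ = + c₀ a
  B₀ = + c₀ b
  Ā₀ = + negDigits p (digit (unit a)) 0

  P∤digit₀ : (u : Unit p) → ¬ P ∣ + digit u 0
  P∤digit₀ u = ∤-small (ℕ.n≢0⇒n>0 (digit0≢0 u)) (digit<p u 0)

  P∤A₀ : ¬ P ∣ A₀
  P∤A₀ = P∤digit₀ (unit a)

  P∤B₀ : ¬ P ∣ B₀
  P∤B₀ = P∤digit₀ (unit b)

  Ā₀≡ : Ā₀ ≡ P - A₀
  Ā₀≡ = sym (trans (ℤ.m-n≡m⊖n p (c₀ a)) (ℤ.⊖-≥ (ℕ.<⇒≤ (digit<p (unit a) 0))))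

  P∤Ā₀ : ¬ P ∣ Ā₀
  P∤Ā₀ h = P∤A₀ (∣-lin₂ (- + 1) (+ 1) h ∣-refl
      (trans (identity A₀ P) (cong (λ z → - + 1 * z + + 1 * P) (sym Ā₀≡))))
    where
    identity : ∀ a P → a ≡ - + 1 * (P - a) + + 1 * P
    identity = solve-∀

  P∣-from-Ā₀ : ∀ t → P ∣ t ^ᶻ 2 - Ā₀ → P ∣ t * t + A₀
  P∣-from-Ā₀ t h = ∣-lin₂ (+ 1) (+ 1) (subst (λ z → P ∣ t ^ᶻ 2 - z) Ā₀≡ h) ∣-refl (identity t A₀ P)
    where
    identity : ∀ t a P → t * t + a ≡ + 1 * (t * (t * + 1) - (P - a)) + + 1 * P
    identity = solve-∀

  P∣-to-Ā₀ : ∀ t → P ∣ t * t + A₀ → P ∣ t ^ᶻ 2 - Ā₀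
  P∣-to-Ā₀ t h = subst (λ z → P ∣ t ^ᶻ 2 - z) (sym Ā₀≡) (∣-lin₂ (+ 1) (- + 1) h ∣-refl (identity t A₀ P))
    where
    identity : ∀ t a P → t * (t * + 1) - (P - a) ≡ + 1 * (t * t + a) + - + 1 * P
    identity = solve-∀

  SolvableAt : ℤ → Set
  SolvableAt w = Σ (Qp× p) λ x → val x ≡ w × IsRoot p a b x

  -- Each constructor names the terms of least valuation among x³, ax, b when |x|_p = p^(-w).
  data LocalCase (w : ℤ) : Set where
    X³,b : + 3 * w ≡ val b → val b < val a + w → B₀ ^ᶻ cubeExp p ≡ᵐ + 1 [mod P ] → LocalCase w
    X³,aX : + 3 * w ≡ val a + w → val a + w < val b → Ā₀ ^ᶻ ((p ℕ.∸ 1) / 2) ≡ᵐ + 1 [mod P ] → LocalCase w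
    aX,b : val a + w ≡ val b → val b < + 3 * w → LocalCase w
    X³,aX,b : + 3 * w ≡ val b → val a + w ≡ val b → CondD p (c₀ a) (c₀ b) → LocalCase w

  module At (w : ℤ) where

    u₁ u₂ u₃ m : ℤ
    u₁ = + 3 * w
    u₂ = val a + w
    u₃ = val b
    m = minℤ (minℤ u₁ u₂) u₃

    m≤u₁ : m ≤ u₁
    m≤u₁ = ℤ.≤-trans (ℤ.i⊓j≤i (u₁ ℤ.⊓ u₂) u₃) (ℤ.i⊓j≤i u₁ u₂)

    m≤u₂ : m ≤ u₂
    m≤u₂ = ℤ.≤-trans (ℤ.i⊓j≤i (u₁ ℤ.⊓ u₂) u₃) (ℤ.i⊓j≤j u₁ u₂)

    m≤u₃ : m ≤ u₃
    m≤u₃ = ℤ.i⊓j≤j (u₁ ℤ.⊓ u₂) u₃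

    minimum : ∀ {u} → u ≤ u₁ → u ≤ u₂ → u ≤ u₃ → m ≤ u → u ≡ m
    minimum h₁ h₂ h₃ h = ℤ.≤-antisym (ℤ.⊓-glb (ℤ.⊓-glb h₁ h₂) h₃) h

    attained : ¬ (m < u₁ × m < u₂ × m < u₃)
    attained (h₁ , h₂ , h₃) with ℤ.⊓-sel (u₁ ℤ.⊓ u₂) u₃
    ... | inj₂ eq = ℤ.<-irrefl eq h₃
    ... | inj₁ eq with ℤ.⊓-sel u₁ u₂
    ... | inj₁ eq′ = ℤ.<-irrefl (trans eq eq′) h₁
    ... | inj₂ eq′ = ℤ.<-irrefl (trans eq eq′) h₂

    -- The power of p left in front of a term of valuation u after division by p^m: it is 1 on the
    -- terms of least valuation and vanishes modulo p on the others.
    k : ℤ → ℤ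
    k u = P ^ᶻ ℤ.∣ u - m ∣

    k≡1 : ∀ {u} → u ≡ m → k u ≡ + 1
    k≡1 {u} eq = cong (λ z → P ^ᶻ ℤ.∣ z ∣) (ℤ.i≡j⇒i-j≡0 {u} {m} eq)

    P∣k : ∀ {u} → m < u → P ∣ k u
    P∣k {u} m<u with ℤ.∣ u - m ∣ in eq
    ... | zero = ⊥-elim (ℤ.<-irrefl (sym (ℤ.i-j≡0⇒i≡j u m (ℤ.∣i∣≡0⇒i≡0 eq))) m<u)
    ... | suc n = ∣m⇒∣m*n (P ^ᶻ n) ∣-refl

    equation : ℤ → ℤ → ℤ → ℤ → ℤ
    equation k₁ k₂ k₃ x = k₁ * (x * x * x) + k₂ * A₀ * x - k₃ * B₀

    reduction : ∀ X → IsRoot p a b (X ·p^ w) → P ∣ equation (k u₁) (k u₂) (k u₃) (+ digit X 0)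
    reduction X root = subst₃ (trunc-1 (digit X)) (trunc-1 (digit (unit a))) (trunc-1 (digit (unit b)))
      (subst (_∣ (k u₁ * (x ^ᶻ 3) + k u₂ * α * x - k u₃ * β)) (ℤ.*-identityʳ P) (∣ᵤ⇒∣ (root 1)))
      where
      x α β : ℤ
      x = trunc p (digit X) 1
      α = trunc p (digit (unit a)) 1
      β = trunc p (digit (unit b)) 1
      identity : ∀ k₁ k₂ k₃ x a b → k₁ * (x * (x * (x * + 1))) + k₂ * a * x - k₃ * b
          ≡ k₁ * (x * x * x) + k₂ * a * x - k₃ * b
      identity = solve-∀
      subst₃ : ∀ {x x′ a a′ b b′} → x ≡ x′ → a ≡ a′ → b ≡ b′ →
        P ∣ k u₁ * (x ^ᶻ 3) + k u₂ * a * x - k u₃ * b → P ∣ k u₁ * (x′ * x′ * x′) + k u₂ * a′ * x′ - k u₃ * b′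
      subst₃ {x} {_} {a} {_} {b} refl refl refl = subst (P ∣_) (identity (k u₁) (k u₂) (k u₃) x a b)

    lifting : ∀ r → ¬ P ∣ r → P ∣ equation (k u₁) (k u₂) (k u₃) r →
              ¬ P ∣ + 3 * k u₁ * (r * r) + k u₂ * A₀ → SolvableAt w
    lifting r P∤r root simple = (lift ·p^ w) , refl , λ n → ∣⇒∣ᵤ
        (subst (P ^ᶻ n ∣_) (identity (k u₁) (k u₂) (k u₃) (trunc p digits n)
            (trunc p (digit (unit a)) n) (trunc p (digit (unit b)) n)) (lift-root n))
      where
      identity : ∀ k₁ k₂ k₃ x a b → k₁ * (x * x * x) + k₂ * a * x - k₃ * b
          ≡ k₁ * (x * (x * (x * + 1))) + k₂ * a * x - k₃ * b
      identity = solve-∀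
      identity₂ : ∀ k t t′ → k * t′ - k * t ≡ k * (t′ - t)
      identity₂ = solve-∀
      coherent : ∀ k d n → P ^ᶻ n ∣ k * trunc p d (suc n) - k * trunc p d n
      coherent k d n = ∣-lin₁ k (trunc-coherent d n) (identity₂ k (trunc p d n) (trunc p d (suc n)))
      open Lift (k u₁) (λ n → k u₂ * trunc p (digit (unit a)) n) (λ n → k u₃ * trunc p (digit (unit b)) n)
        (coherent (k u₂) (digit (unit a))) (coherent (k u₃) (digit (unit b))) r P∤r
        (subst (P ∣_) (sym (cong₂ (λ y z → k u₁ * (r * r * r) + k u₂ * y * r - k u₃ * z)
            (trunc-1 (digit (unit a))) (trunc-1 (digit (unit b))))) root)
        (subst (λ y → ¬ P ∣ + 3 * k u₁ * (r * r) + k u₂ * y) (sym (trunc-1 (digit (unit a)))) simple)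

    compare : ∀ {u} → m ≤ u → u ≡ m ⊎ m < u
    compare {u} m≤u with ℤ.<-cmp m u
    ... | tri< h _ _ = inj₂ h
    ... | tri≈ _ h _ = inj₁ (sym h)
    ... | tri> _ _ h = ⊥-elim (ℤ.<⇒≱ h m≤u)

    equation-cong : ∀ {k₁ k₁′ k₂ k₂′ k₃ k₃′} x → k₁ ≡ k₁′ → k₂ ≡ k₂′ → k₃ ≡ k₃′ →
                    P ∣ equation k₁ k₂ k₃ x → P ∣ equation k₁′ k₂′ k₃′ x
    equation-cong x refl refl refl h = h

    -- Modulo p only the terms of least valuation survive. There is at least one, and a single one
    -- would be a unit congruent to 0, so two or three remain. Their congruence gives the condition
    -- of the case, except that ax ≡ b constrains neither a nor b.
    necessary : ∀ x → ¬ P ∣ x → P ∣ equation (k u₁) (k u₂) (k u₃) x →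
                u₁ ≡ m ⊎ m < u₁ → u₂ ≡ m ⊎ m < u₂ → u₃ ≡ m ⊎ m < u₃ → LocalCase w
    necessary x P∤x h (inj₁ e₁) (inj₁ e₂) (inj₁ e₃) =
      X³,aX,b (trans e₁ (sym e₃)) (trans e₂ (sym e₃)) (root⇒condD P∤A₀ P∤B₀ x
        (subst (P ∣_) (identity x A₀ B₀) (equation-cong x (k≡1 e₁) (k≡1 e₂) (k≡1 e₃) h)))
      where
      identity : ∀ x a b → + 1 * (x * x * x) + + 1 * a * x - + 1 * b ≡ x * x * x + a * x - b
      identity = solve-∀
    necessary x P∤x h (inj₁ e₁) (inj₁ e₂) (inj₂ l₃) =
      X³,aX (trans e₁ (sym e₂)) (subst (_< u₃) (sym e₂) l₃) (∣⇒∣ᵤ (square⇒euler Ā₀ P∤Ā₀ x (P∣-to-Ā₀ x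
        (cancel P∤x (∣-lin₂ (+ 1) B₀ (equation-cong x (k≡1 e₁) (k≡1 e₂) (refl {x = k u₃}) h)
            (P∣k l₃) (identity x A₀ B₀ (k u₃)))))))
      where
      identity : ∀ x a b k₃ → x * (x * x + a) ≡ + 1 * (+ 1 * (x * x * x) + + 1 * a * x - k₃ * b) + b * k₃
      identity = solve-∀
    necessary x P∤x h (inj₁ e₁) (inj₂ l₂) (inj₁ e₃) =
      X³,b (trans e₁ (sym e₃)) (subst (_< u₂) (sym e₃) l₂) (∣⇒∣ᵤ (cube⇒euler B₀ P∤B₀ x
        (∣-lin₂ (+ 1) (- (A₀ * x)) (equation-cong x (k≡1 e₁) (refl {x = k u₂}) (k≡1 e₃) h) (P∣k l₂)
            (identity x A₀ B₀ (k u₂)))))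
      where
      identity : ∀ x a b k₂ → x * (x * (x * + 1)) - b
          ≡ + 1 * (+ 1 * (x * x * x) + k₂ * a * x - + 1 * b) + - (a * x) * k₂
      identity = solve-∀
    necessary x P∤x h (inj₂ l₁) (inj₁ e₂) (inj₁ e₃) = aX,b (trans e₂ (sym e₃)) (subst (_< u₁) (sym e₃) l₁)
    necessary x P∤x h (inj₁ e₁) (inj₂ l₂) (inj₂ l₃) = ⊥-elim (∤-* P∤x (∤-* P∤x P∤x)
      (∣-lin₃ (+ 1) (- (A₀ * x)) B₀ (equation-cong x (k≡1 e₁) (refl {x = k u₂}) (refl {x = k u₃}) h)
          (P∣k l₂) (P∣k l₃) (identity x A₀ B₀ (k u₂) (k u₃))))
      where
      identity : ∀ x a b k₂ k₃ → x * (x * x)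
          ≡ + 1 * (+ 1 * (x * x * x) + k₂ * a * x - k₃ * b) + - (a * x) * k₂ + b * k₃
      identity = solve-∀
    necessary x P∤x h (inj₂ l₁) (inj₁ e₂) (inj₂ l₃) = ⊥-elim (∤-* P∤A₀ P∤x
      (∣-lin₃ (+ 1) (- (x * x * x)) B₀
          (equation-cong x (refl {x = k u₁}) (k≡1 e₂) (refl {x = k u₃}) h) (P∣k l₁) (P∣k l₃)
              (identity x A₀ B₀ (k u₁) (k u₃))))
      where
      identity : ∀ x a b k₁ k₃ → a * x
          ≡ + 1 * (k₁ * (x * x * x) + + 1 * a * x - k₃ * b) + - (x * x * x) * k₁ + b * k₃
      identity = solve-∀
    necessary x P∤x h (inj₂ l₁) (inj₂ l₂) (inj₁ e₃) = ⊥-elim (P∤B₀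
      (∣-lin₃ (- + 1) (x * x * x) (A₀ * x)
          (equation-cong x (refl {x = k u₁}) (refl {x = k u₂}) (k≡1 e₃) h) (P∣k l₁) (P∣k l₂)
              (identity x A₀ B₀ (k u₁) (k u₂))))
      where
      identity : ∀ x a b k₁ k₂ → b ≡ - + 1 * (k₁ * (x * x * x) + k₂ * a * x - + 1 * b) + x * x * x * k₁ + a * x * k₂
      identity = solve-∀
    necessary x P∤x h (inj₂ l₁) (inj₂ l₂) (inj₂ l₃) = ⊥-elim (attained (l₁ , l₂ , l₃))

    -- Modulo p the derivative is 3r², nonzero because p > 3 and r³ ≡ b.
    cube⇒root : u₁ ≡ u₃ → u₃ < u₂ → ∀ r → P ∣ r ^ᶻ 3 - B₀ → SolvableAt w
    cube⇒root u₁≡u₃ u₃<u₂ r r³≡b = lifting r P∤r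
        (equation-cong r (sym (k≡1 u₁≡m)) (refl {x = k u₂}) (sym (k≡1 u₃≡m))
          (∣-lin₂ (+ 1) (A₀ * r) r³≡b (P∣k m<u₂) (identity r A₀ B₀ (k u₂))))
        (subst (λ k₁ → ¬ P ∣ + 3 * k₁ * (r * r) + k u₂ * A₀) (sym (k≡1 u₁≡m)) λ s →
          ∤-* P∤3 (∤-* P∤r P∤r) (∣-lin₂ (+ 1) (- A₀) s (P∣k m<u₂) (identity₂ r A₀ (k u₂))))
      where
      identity : ∀ r a b k₂ → + 1 * (r * r * r) + k₂ * a * r - + 1 * b
          ≡ + 1 * (r * (r * (r * + 1)) - b) + a * r * k₂
      identity = solve-∀
      identity₂ : ∀ r a k₂ → + 3 * (r * r) ≡ + 1 * (+ 3 * + 1 * (r * r) + k₂ * a) + - a * k₂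
      identity₂ = solve-∀
      identity₃ : ∀ r b → b ≡ r * r * r + - + 1 * (r * (r * (r * + 1)) - b)
      identity₃ = solve-∀
      P∤r : ¬ P ∣ r
      P∤r P∣r = P∤B₀ (∣-lin₂ (r * r) (- + 1) P∣r r³≡b (identity₃ r B₀))
      u₃≡m : u₃ ≡ m
      u₃≡m = minimum (ℤ.≤-reflexive (sym u₁≡u₃)) (ℤ.<⇒≤ u₃<u₂) ℤ.≤-refl m≤u₃
      u₁≡m : u₁ ≡ m
      u₁≡m = trans u₁≡u₃ u₃≡m
      m<u₂ : m < u₂
      m<u₂ = subst (_< u₂) u₃≡m u₃<u₂

    -- The derivative 3r² + a is 2r² modulo p, since r² ≡ -a.
    square⇒root : u₁ ≡ u₂ → u₂ < u₃ → ∀ r → P ∣ r ^ᶻ 2 - Ā₀ → SolvableAt w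
    square⇒root u₁≡u₂ u₂<u₃ r r²≡-a = lifting r P∤r
        (equation-cong r (sym (k≡1 u₁≡m)) (sym (k≡1 u₂≡m)) (refl {x = k u₃})
          (∣-lin₂ r (- B₀) r²+a≡0 (P∣k m<u₃) (identity r A₀ B₀ (k u₃))))
        (λ s → ∤-* P∤2 (∤-* P∤r P∤r) (∣-lin₂ (+ 1) (- + 1)
          (subst₂ (λ k₁ k₂ → P ∣ + 3 * k₁ * (r * r) + k₂ * A₀) (k≡1 u₁≡m) (k≡1 u₂≡m) s) r²+a≡0
              (identity₂ r A₀)))
      where
      r²+a≡0 : P ∣ r * r + A₀
      r²+a≡0 = P∣-from-Ā₀ r r²≡-a
      identity : ∀ r a b k₃ → + 1 * (r * r * r) + + 1 * a * r - k₃ * b ≡ r * (r * r + a) + - b * k₃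
      identity = solve-∀
      identity₂ : ∀ r a → + 2 * (r * r) ≡ + 1 * (+ 3 * + 1 * (r * r) + + 1 * a) + - + 1 * (r * r + a)
      identity₂ = solve-∀
      identity₃ : ∀ r a → a ≡ - r * r + + 1 * (r * r + a)
      identity₃ = solve-∀
      P∤r : ¬ P ∣ r
      P∤r P∣r = P∤A₀ (∣-lin₂ (- r) (+ 1) P∣r r²+a≡0 (identity₃ r A₀))
      u₂≡m : u₂ ≡ m
      u₂≡m = minimum (ℤ.≤-reflexive (sym u₁≡u₂)) ℤ.≤-refl (ℤ.<⇒≤ u₂<u₃) m≤u₂
      u₁≡m : u₁ ≡ m
      u₁≡m = trans u₁≡u₂ u₂≡m
      m<u₃ : m < u₃
      m<u₃ = subst (_< u₃) u₂≡m u₂<u₃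

    -- The reduction is linear, with root b/a and derivative a.
    inverse⇒root : u₂ ≡ u₃ → u₃ < u₁ → ∀ i → P ∣ A₀ * i - + 1 → SolvableAt w
    inverse⇒root u₂≡u₃ u₃<u₁ i ai≡1 = lifting r P∤r
        (equation-cong r (refl {x = k u₁}) (sym (k≡1 u₂≡m)) (sym (k≡1 u₃≡m))
          (∣-lin₂ (r * r * r) B₀ (P∣k m<u₁) ai≡1 (identity A₀ B₀ i (k u₁))))
        (subst (λ k₂ → ¬ P ∣ + 3 * k u₁ * (r * r) + k₂ * A₀) (sym (k≡1 u₂≡m)) λ s →
          P∤A₀ (∣-lin₂ (+ 1) (- (+ 3 * (r * r))) s (P∣k m<u₁) (identity₂ r A₀ (k u₁))))
      where
      r : ℤ
      r = B₀ * i
      identity : ∀ a b i k₁ → let r = b * i in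
        k₁ * (r * r * r) + + 1 * a * r - + 1 * b ≡ r * r * r * k₁ + b * (a * i - + 1)
      identity = solve-∀
      identity₂ : ∀ r a k₁ → a ≡ + 1 * (+ 3 * k₁ * (r * r) + + 1 * a) + - (+ 3 * (r * r)) * k₁
      identity₂ = solve-∀
      identity₃ : ∀ a b i → b ≡ a * (b * i) + - b * (a * i - + 1)
      identity₃ = solve-∀
      P∤r : ¬ P ∣ r
      P∤r P∣r = P∤B₀ (∣-lin₂ A₀ (- B₀) P∣r ai≡1 (identity₃ A₀ B₀ i))
      u₃≡m : u₃ ≡ m
      u₃≡m = minimum (ℤ.<⇒≤ u₃<u₁) (ℤ.≤-reflexive (sym u₂≡u₃)) ℤ.≤-refl m≤u₃
      u₂≡m : u₂ ≡ m
      u₂≡m = trans u₂≡u₃ u₃≡m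
      m<u₁ : m < u₁
      m<u₁ = subst (_< u₁) u₃≡m u₃<u₁

    simple-root⇒root : u₁ ≡ u₃ → u₂ ≡ u₃ → ∀ r → P ∣ r * r * r + A₀ * r - B₀
        → ¬ P ∣ + 3 * (r * r) + A₀ → SolvableAt w
    simple-root⇒root u₁≡u₃ u₂≡u₃ r fr f′r = lifting r (root-nonzero P∤B₀ r fr)
        (equation-cong r (sym (k≡1 u₁≡m)) (sym (k≡1 u₂≡m)) (sym (k≡1 u₃≡m))
            (subst (P ∣_) (identity r A₀ B₀) fr))
        (λ s → f′r (subst (P ∣_) (identity₂ r A₀)
          (subst₂ (λ k₁ k₂ → P ∣ + 3 * k₁ * (r * r) + k₂ * A₀) (k≡1 u₁≡m) (k≡1 u₂≡m) s)))
      where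
      identity : ∀ x a b → x * x * x + a * x - b ≡ + 1 * (x * x * x) + + 1 * a * x - + 1 * b
      identity = solve-∀
      identity₂ : ∀ r a → + 3 * + 1 * (r * r) + + 1 * a ≡ + 3 * (r * r) + a
      identity₂ = solve-∀
      u₃≡m : u₃ ≡ m
      u₃≡m = minimum (ℤ.≤-reflexive (sym u₁≡u₃)) (ℤ.≤-reflexive (sym u₂≡u₃)) ℤ.≤-refl m≤u₃
      u₁≡m : u₁ ≡ m
      u₁≡m = trans u₁≡u₃ u₃≡m
      u₂≡m : u₂ ≡ m
      u₂≡m = trans u₂≡u₃ u₃≡m

    sufficient : LocalCase w → SolvableAt w
    sufficient (X³,b e l h) = uncurry (cube⇒root e l) (euler⇒cube B₀ (∣ᵤ⇒∣ h))
    sufficient (X³,aX e l h) = uncurry (square⇒root e l) (euler⇒square Ā₀ (∣ᵤ⇒∣ h))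
    sufficient (aX,b e l) = uncurry (inverse⇒root e l) (inverse A₀ P∤A₀)
    sufficient (X³,aX,b e e′ D≢) = let r , fr , f′r = condD⇒simple-root P∤B₀ D≢ in simple-root⇒root e e′ r fr f′r

  root⇒local : (x : Qp× p) → IsRoot p a b x → LocalCase (val x)
  root⇒local (X ·p^ w) root = necessary (+ digit X 0) (P∤digit₀ X) (reduction X root)
      (compare m≤u₁) (compare m≤u₂) (compare m≤u₃)
    where open At w

  local⇒root : ∀ w → LocalCase w → SolvableAt w
  local⇒root = At.sufficient

-- Valuations

-- When two differences are proportional with positive factors c and d, an inequality transfers from
-- one to the other; each comparison of valuations thereby becomes a ring identity.
linear-< : ∀ c d .{{_ : ℤ.Positive c}} .{{_ : ℤ.Positive d}} {x y i j} →
           x < y → c * (j - i) ≡ d * (y - x) → i < j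
linear-< c d {x} {y} {i} {j} x<y eq = subst₂ _<_ (ℤ.+-identityˡ i) (identity j i) (ℤ.+-monoˡ-< i 0<j-i)
  where
  identity : ∀ j i → j - i + i ≡ j
  identity = solve-∀
  0<y-x : + 0 < y - x
  0<y-x = subst (_< y - x) (ℤ.+-inverseʳ x) (ℤ.+-monoˡ-< (- x) x<y)
  0<j-i : + 0 < j - i
  0<j-i = ℤ.*-cancelˡ-<-nonNeg c {{ℤ.nonNegative (ℤ.<⇒≤ (ℤ.positive⁻¹ c))}}
    (subst₂ _<_ (trans (ℤ.*-zeroʳ d) (sym (ℤ.*-zeroʳ c))) (sym eq) (ℤ.*-monoˡ-<-pos d 0<y-x))

<-or-≥ : ∀ i j → i < j ⊎ j ≤ i
<-or-≥ i j with i ℤ.<? j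
... | yes i<j = inj₁ i<j
... | no i≮j = inj₂ (ℤ.≮⇒≥ i≮j)

*-pos : ∀ {w} c .{{_ : ℤ.Positive c}} → + 0 < w → + 0 < c * w
*-pos {w} c 0<w = linear-< (+ 1) c 0<w (identity c w)
  where
  identity : ∀ c w → + 1 * (c * w - + 0) ≡ c * (w - + 0)
  identity = solve-∀

*-neg : ∀ {w} c .{{_ : ℤ.Positive c}} → w < + 0 → c * w < + 0
*-neg {w} c w<0 = linear-< (+ 1) c w<0 (identity c w)
  where
  identity : ∀ c w → + 1 * (+ 0 - c * w) ≡ c * (+ 0 - w)
  identity = solve-∀

*-pos⁻ : ∀ {w} c .{{_ : ℤ.Positive c}} → + 0 < c * w → + 0 < w
*-pos⁻ {w} c h = linear-< c (+ 1) h (identity c w)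
  where
  identity : ∀ c w → c * (w - + 0) ≡ + 1 * (c * w - + 0)
  identity = solve-∀

*-neg⁻ : ∀ {w} c .{{_ : ℤ.Positive c}} → c * w < + 0 → w < + 0
*-neg⁻ {w} c h = linear-< c (+ 1) h (identity c w)
  where
  identity : ∀ c w → c * (+ 0 - w) ≡ + 1 * (+ 0 - c * w)
  identity = solve-∀

multiple-neg : ∀ c w → c ℤ∣.∣ - (c * w)
multiple-neg c w = ∣⇒∣ᵤ (divides (- w) (identity c w))
  where
  identity : ∀ c w → - (c * w) ≡ - w * c
  identity = solve-∀

neg-multiple : ∀ c v → c ℤ∣.∣ - v → ∃ λ w → v ≡ c * w
neg-multiple c v h with ∣ᵤ⇒∣ {c} { - v} h
... | divides q eq = - q , trans (sym (ℤ.neg-involutive v)) (trans (cong -_ eq) (identity c q))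
  where
  identity : ∀ c q → - (q * c) ≡ c * - q
  identity = solve-∀

module Valuations (α β : ℤ) where

  -- With β = 3w, both inequalities say 2w < α.
  X³,b-< : ∀ w → + 3 * w ≡ β → β < α + w → + 2 * β < + 3 * α
  X³,b-< w refl h = linear-< (+ 1) (+ 3) h (identity α w)
    where
    identity : ∀ α w → + 1 * (+ 3 * α - + 2 * (+ 3 * w)) ≡ + 3 * (α + w - + 3 * w)
    identity = solve-∀

  X³,b-<⁻ : ∀ w → β ≡ + 3 * w → + 2 * β < + 3 * α → β < α + w
  X³,b-<⁻ w refl h = linear-< (+ 3) (+ 1) h (identity α w)
    where
    identity : ∀ α w → + 3 * (α + w - + 3 * w) ≡ + 1 * (+ 3 * α - + 2 * (+ 3 * w))
    identity = solve-∀

  α≡2w : ∀ w → + 3 * w ≡ α + w → α ≡ + 2 * w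
  α≡2w w eq = trans (identity₁ α w) (trans (cong (_- w) (sym eq)) (identity₂ w))
    where
    identity₁ : ∀ α w → α ≡ α + w - w
    identity₁ = solve-∀
    identity₂ : ∀ w → + 3 * w - w ≡ + 2 * w
    identity₂ = solve-∀

  α≡2w⁻ : ∀ w → α ≡ + 2 * w → + 3 * w ≡ α + w
  α≡2w⁻ w refl = identity w
    where
    identity : ∀ w → + 3 * w ≡ + 2 * w + w
    identity = solve-∀

  -- With α = 2w, both inequalities say 3w < β.
  X³,aX-< : ∀ w → α ≡ + 2 * w → α + w < β → + 3 * α < + 2 * β
  X³,aX-< w refl h = linear-< (+ 1) (+ 2) h (identity β w)
    where
    identity : ∀ β w → + 1 * (+ 2 * β - + 3 * (+ 2 * w)) ≡ + 2 * (β - (+ 2 * w + w))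
    identity = solve-∀

  X³,aX-<⁻ : ∀ w → α ≡ + 2 * w → + 3 * α < + 2 * β → α + w < β
  X³,aX-<⁻ w refl h = linear-< (+ 2) (+ 1) h (identity β w)
    where
    identity : ∀ β w → + 2 * (β - (+ 2 * w + w)) ≡ + 1 * (+ 2 * β - + 3 * (+ 2 * w))
    identity = solve-∀

  α<α+w : ∀ w → + 0 < w → α < α + w
  α<α+w w h = linear-< (+ 1) (+ 1) h (identity α w)
    where
    identity : ∀ α w → + 1 * (α + w - α) ≡ + 1 * (w - + 0)
    identity = solve-∀

  α+w<α : ∀ w → w < + 0 → α + w < α
  α+w<α w h = linear-< (+ 1) (+ 1) h (identity α w)
    where
    identity : ∀ α w → + 1 * (α - (α + w)) ≡ + 1 * (+ 0 - w)
    identity = solve-∀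

  -- With β = α + w, both inequalities say α < 2w.
  aX,b-< : ∀ w → α + w ≡ β → β < + 3 * w → + 3 * α < + 2 * β
  aX,b-< w refl h = linear-< (+ 1) (+ 1) h (identity α w)
    where
    identity : ∀ α w → + 1 * (+ 2 * (α + w) - + 3 * α) ≡ + 1 * (+ 3 * w - (α + w))
    identity = solve-∀

  aX,b-<⁻ : + 3 * α < + 2 * β → β < + 3 * (β - α)
  aX,b-<⁻ h = linear-< (+ 1) (+ 1) h (identity α β)
    where
    identity : ∀ α β → + 1 * (+ 3 * (β - α) - β) ≡ + 1 * (+ 2 * β - + 3 * α)
    identity = solve-∀

  α+[β-α]≡β : α + (β - α) ≡ β
  α+[β-α]≡β = identity α β
    where
    identity : ∀ α β → α + (β - α) ≡ β
    identity = solve-∀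

  0<β-α : α < β → + 0 < β - α
  0<β-α h = linear-< (+ 1) (+ 1) h (identity α β)
    where
    identity : ∀ α β → + 1 * (β - α - + 0) ≡ + 1 * (β - α)
    identity = solve-∀

  β-α<0 : β < α → β - α < + 0
  β-α<0 h = linear-< (+ 1) (+ 1) h (identity α β)
    where
    identity : ∀ α β → + 1 * (+ 0 - (β - α)) ≡ + 1 * (α - β)
    identity = solve-∀

  balanced : ∀ w → + 3 * w ≡ β → α + w ≡ β → + 3 * α ≡ + 2 * β
  balanced w e e′ rewrite sym e | α≡2w w (sym e′) = identity w
    where
    identity : ∀ w → + 3 * (+ 2 * w) ≡ + 2 * (+ 3 * w)
    identity = solve-∀

  balanced⁻ : + 3 * α ≡ + 2 * β → + 3 * (β - α) ≡ β
  balanced⁻ e = trans (identity₁ α β) (trans (cong (_-_ (+ 3 * β)) e) (identity₂ β))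
    where
    identity₁ : ∀ α β → + 3 * (β - α) ≡ + 3 * β - + 3 * α
    identity₁ = solve-∀
    identity₂ : ∀ β → + 3 * β - + 2 * β ≡ β
    identity₂ = solve-∀

-- The three regions: valuation zero, positive and negative

theorem5p1 : (p : ℕ) → Prime p → 3 Data.Nat.< p → (a b : Qp× p) →
    ((Σ (Qp× p) (λ x → val x ≡ + 0 × IsRoot p a b x)) ⇔
    ((val b ≡ + 0 × + 0 < val a × ∛ b exists)
    ⊎ (val a ≡ + 0 × + 0 < val b × √- a exists)
    ⊎ (val a ≡ + 0 × val b ≡ + 0 × CondD p (c₀ a) (c₀ b))
    ⊎ (val a ≡ val b × val a < + 0)))
    ×
    ((Σ (Qp× p) (λ x → + 0 < val x × IsRoot p a b x)) ⇔
    (((+ 2) * val b < (+ 3) * val a × + 0 < val b × ∛ b exists)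
    ⊎ ((+ 3) * val a ≡ (+ 2) * val b × + 0 < val b × CondD p (c₀ a) (c₀ b))
    ⊎ ((+ 3) * val a < (+ 2) * val b × val a < val b)))
    ×
    ((Σ (Qp× p) (λ x → val x < + 0 × IsRoot p a b x)) ⇔
    (((+ 2) * val b < (+ 3) * val a × val b < + 0 × ∛ b exists)
    ⊎ ((+ 3) * val a ≡ (+ 2) * val b × val b < + 0 × CondD p (c₀ a) (c₀ b))
    ⊎ ((+ 3) * val a < (+ 2) * val b
    × (val b < val a ⊎ (val a ≤ val b × val a < + 0 × √- a exists)))))
theorem5p1 p pp 3<p a b = mk⇔ I→ I← , mk⇔ II→ II← , mk⇔ III→ III←
  where
  open Local p pp 3<p a b
  α β : ℤ
  α = val a
  β = val b
  open Valuations α β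

  I→local : LocalCase (+ 0) →
    (β ≡ + 0 × + 0 < α × ∛ b exists) ⊎ (α ≡ + 0 × + 0 < β × √- a exists)
    ⊎ (α ≡ + 0 × β ≡ + 0 × CondD p (c₀ a) (c₀ b)) ⊎ (α ≡ β × α < + 0)
  I→local (X³,b e l h) = inj₁ (sym e , subst₂ _<_ (sym e) (ℤ.+-identityʳ α) l ,
    h , subst (λ v → + 3 ℤ∣.∣ - v) e (multiple-neg (+ 3) (+ 0)))
  I→local (X³,aX e l h) = inj₂ (inj₁ (α≡2w (+ 0) e , subst (_< β) (sym e) l ,
    h , subst (λ v → + 2 ℤ∣.∣ - v) (sym (α≡2w (+ 0) e)) (multiple-neg (+ 2) (+ 0))))
  I→local (X³,aX,b e e′ h) = inj₂ (inj₂ (inj₁ (trans (sym (ℤ.+-identityʳ α)) (trans e′ (sym e)) , sym e , h)))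
  I→local (aX,b e l) = let α≡β = trans (sym (ℤ.+-identityʳ α)) e in
    inj₂ (inj₂ (inj₂ (α≡β , subst (_< + 0) (sym α≡β) l)))

  I→ : _ → _
  I→ (x , v≡0 , root) = I→local (subst LocalCase v≡0 (root⇒local x root))

  I← : _ → _
  I← (inj₁ (e , l , h , _)) = local⇒root (+ 0) (X³,b (sym e) (subst₂ _<_ (sym e) (sym (ℤ.+-identityʳ α)) l) h)
  I← (inj₂ (inj₁ (e , l , h , _))) = local⇒root (+ 0)
    (X³,aX (α≡2w⁻ (+ 0) e) (subst (_< β) (α≡2w⁻ (+ 0) e) l) h)
  I← (inj₂ (inj₂ (inj₁ (e , e′ , h)))) = local⇒root (+ 0)
    (X³,aX,b (sym e′) (trans (ℤ.+-identityʳ α) (trans e (sym e′))) h)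
  I← (inj₂ (inj₂ (inj₂ (e , l)))) = local⇒root (+ 0) (aX,b (trans (ℤ.+-identityʳ α) e) (subst (_< + 0) e l))

  solution : ∀ {Q : ℤ → Set} w → Q w → LocalCase w → Σ (Qp× p) λ x → Q (val x) × IsRoot p a b x
  solution {Q} w q c = let x , v≡w , root = local⇒root w c in x , subst Q (sym v≡w) q , root

  II→local : ∀ w → + 0 < w → LocalCase w →
    (+ 2 * β < + 3 * α × + 0 < β × ∛ b exists)
    ⊎ (+ 3 * α ≡ + 2 * β × + 0 < β × CondD p (c₀ a) (c₀ b)) ⊎ (+ 3 * α < + 2 * β × α < β)
  II→local w 0<w (X³,b e l h) = inj₁ (X³,b-< w e l , subst (+ 0 <_) e (*-pos (+ 3) 0<w) ,
    h , subst (λ v → + 3 ℤ∣.∣ - v) e (multiple-neg (+ 3) w))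
  -- For w > 0 the balance of x³ with ax already forces α < α + w < β. In that range the balance of
  -- ax with b always gives a root, so no square root condition appears.
  II→local w 0<w (X³,aX e l h) = inj₂ (inj₂ (X³,aX-< w (α≡2w w e) l , ℤ.<-trans (α<α+w w 0<w) l))
  II→local w 0<w (aX,b e l) = inj₂ (inj₂ (aX,b-< w e l , subst (α <_) e (α<α+w w 0<w)))
  II→local w 0<w (X³,aX,b e e′ h) = inj₂ (inj₁ (balanced w e e′ , subst (+ 0 <_) e (*-pos (+ 3) 0<w) , h))

  II→ : _ → _
  II→ (x , 0<v , root) = II→local (val x) 0<v (root⇒local x root)

  II← : _ → _
  -- The divisibility contained in the existence of the cube root supplies the valuation w = β/3.
  II← (inj₁ (l , 0<β , h , d)) = let w , e = neg-multiple (+ 3) β d in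
    solution w (*-pos⁻ (+ 3) (subst (+ 0 <_) e 0<β)) (X³,b (sym e) (X³,b-<⁻ w e l) h)
  -- The balance α + w = β leaves only w = β - α, and 3α = 2β makes this β/3 as well.
  II← (inj₂ (inj₁ (e , 0<β , h))) =
    solution (β - α) (*-pos⁻ (+ 3) (subst (+ 0 <_) (sym (balanced⁻ e)) 0<β))
        (X³,aX,b (balanced⁻ e) α+[β-α]≡β h)
  II← (inj₂ (inj₂ (l , α<β))) = solution (β - α) (0<β-α α<β) (aX,b α+[β-α]≡β (aX,b-<⁻ l))

  III→local : ∀ w → w < + 0 → LocalCase w →
    (+ 2 * β < + 3 * α × β < + 0 × ∛ b exists)
    ⊎ (+ 3 * α ≡ + 2 * β × β < + 0 × CondD p (c₀ a) (c₀ b))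
    ⊎ (+ 3 * α < + 2 * β × (β < α ⊎ (α ≤ β × α < + 0 × √- a exists)))
  III→local w w<0 (X³,b e l h) = inj₁ (X³,b-< w e l , subst (_< + 0) e (*-neg (+ 3) w<0) ,
    h , subst (λ v → + 3 ℤ∣.∣ - v) e (multiple-neg (+ 3) w))
  -- If β < α, the first alternative holds outright; the square root condition is recorded only for
  -- α ≤ β.
  III→local w w<0 (X³,aX e l h) = inj₂ (inj₂ (X³,aX-< w (α≡2w w e) l , Sum.map₂ (λ α≤β → α≤β ,
    subst (_< + 0) (sym (α≡2w w e)) (*-neg (+ 2) w<0) ,
    h , subst (λ v → + 2 ℤ∣.∣ - v) (sym (α≡2w w e)) (multiple-neg (+ 2) w)) (<-or-≥ β α)))
  III→local w w<0 (aX,b e l) = inj₂ (inj₂ (aX,b-< w e l , inj₁ (subst (_< α) e (α+w<α w w<0))))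
  III→local w w<0 (X³,aX,b e e′ h) = inj₂ (inj₁ (balanced w e e′ , subst (_< + 0) e (*-neg (+ 3) w<0) , h))

  III→ : _ → _
  III→ (x , v<0 , root) = III→local (val x) v<0 (root⇒local x root)

  III← : _ → _
  III← (inj₁ (l , β<0 , h , d)) = let w , e = neg-multiple (+ 3) β d in
    solution w (*-neg⁻ (+ 3) (subst (_< + 0) e β<0)) (X³,b (sym e) (X³,b-<⁻ w e l) h)
  III← (inj₂ (inj₁ (e , β<0 , h))) =
    solution (β - α) (*-neg⁻ (+ 3) (subst (_< + 0) (sym (balanced⁻ e)) β<0))
        (X³,aX,b (balanced⁻ e) α+[β-α]≡β h)
  III← (inj₂ (inj₂ (l , inj₁ β<α))) = solution (β - α) (β-α<0 β<α) (aX,b α+[β-α]≡β (aX,b-<⁻ l))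
  -- Balancing ax with b would give the valuation β - α ≥ 0 here, so the root comes from x³ and ax,
  -- with w = α/2.
  III← (inj₂ (inj₂ (l , inj₂ (_ , α<0 , h , d)))) = let w , e = neg-multiple (+ 2) α d in
    solution w (*-neg⁻ (+ 2) (subst (_< + 0) e α<0)) (X³,aX (α≡2w⁻ w e) (X³,aX-<⁻ w e l) h)
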